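{- Let $n \ge 3$ and let $\boldsymbol{a} = (a_1, a_2, \ldots, a_n)^T$ be a vector of positive integers with $a_1 \le a_2 \le \cdots \le a_n$ whose entries are pairwise coprime, i.e. $\gcd(a_i,a_j)=1$ for all $i,j\in\{1,\ldots,n\}$ with $i \neq j$. Then $F(\boldsymbol{a}) \le UB_1(\boldsymbol{a})$ and $F(\boldsymbol{a}) \le UB_2(\boldsymbol{a})$, where $UB_2(\boldsymbol{a})$ is sharper only when $$ \begin{aligned} (a_1,a_2,a_3) \in \{&(1,2,3),(1,2,5),(1,2,7),(1,2,9),(1,2,11),(1,2,13),(1,2,15),\\ &(1,2,17),(1,2,19),(1,2,21),(1,2,23),(1,2,25),(1,3,4),(1,3,5),\\ &(1,3,7),(1,3,8),(1,3,10),(1,3,11),(1,3,13),(1,3,14),(1,4,5),\\ &(1,4,7),(1,4,9),(1,4,11),(1,5,6),(1,5,7),(1,5,8),(1,5,9),(1,6,7),(2,3,5)\}. \end{aligned} $$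
   Context: For a vector $\boldsymbol{a}=(a_1,\ldots,a_n)^T$ of positive integers with $n\ge 2$ and $\gcd(a_1,\ldots,a_n)=1$, the Frobenius number is $F(\boldsymbol{a}) := \max\{ b \in \mathbb{Z} : b \ne \sum_{i=1}^n a_i z_i \text{ for all } (z_1,\ldots,z_n) \in \mathbb{Z}_{\ge 0}^n \}$, the largest integer (possibly negative) that is not a nonnegative integer combination of the $a_i$. The two bounds depend only on the first three entries of $\boldsymbol{a}$ and are $$UB_1(\boldsymbol{a}) = UB_1(a_1,a_2,a_3) := \frac{1}{2}\left(\sqrt{\frac{1}{3}(a_1+a_2+a_3)(a_1+a_2+a_3+2a_1a_2a_3)+\frac{8}{3}(a_1a_2+a_2a_3+a_3a_1)}-a_1-a_2-a_3\right),$$ $$UB_2(\boldsymbol{a}) = UB_2(a_1,a_2,a_3) := \frac{1}{2}\left(\sqrt{a_1a_2a_3(a_1+a_2+a_3)}-a_1-a_2-a_3\right).$$ Here "sharper" means giving the smaller (tighter) upper bound of the two.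
   Formalization: The claim that UB_2 is sharper only for the listed triples is proved under the added assumption a_1 < a_2, because it fails for every triple (1,1,k), where UB_2 < UB_1 but the triple is not listed; both upper bounds are proved without it. -}

module Defs where

open import Data.Fin.Patterns using (0F; 1F; 2F)
open import Data.Integer as ℤ using (ℤ; +_)
open import Data.List using (List; []; _∷_)
open import Data.Nat as ℕ using (ℕ)
open import Data.Product using (∃; ∃-syntax; _×_; _,_)
open import Data.Rational
open import Data.Rational.Properties
open import Data.Rational.Solver using (module +-*-Solver)
open import Data.Sum using (_⊎_; inj₁; inj₂)
open import Data.Vec as Vec using (Vec; lookup)
open import Level using (0ℓ)
open import Relation.Binary.PropositionalEquality
open import Relation.Nullary using (¬_; yes; no; contradiction)
open import Relation.Unary using (Pred)

open +-*-Solver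

------------------------------------------------------------------------
-- Frobenius numbers

Representable : ∀ {n} → Vec ℕ n → Pred ℤ 0ℓ
Representable {n} a b = ∃[ z ] b ≡ + Vec.sum (Vec.zipWith ℕ._*_ a z)

Greatest : Pred ℤ 0ℓ → Pred ℤ 0ℓ
Greatest P m = P m × (∀ b → P b → b ℤ.≤ m)

-- A relation rather than a function: the maximum exists exactly when the
-- entries of `a` have gcd 1, and it is unique by antisymmetry of _≤_.

IsFrobeniusNumber : ∀ {n} → Vec ℕ n → Pred ℤ 0ℓ
IsFrobeniusNumber a = Greatest (λ b → ¬ Representable a b)

------------------------------------------------------------------------
-- Dedekind reals; for a real x, `L q` means q < x, and `U q` means x < q.

record ℝ : Set₁ where
  field
    L U         : Pred ℚ 0ℓ
    L-inhabited : ∃ L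
    U-inhabited : ∃ U
    L-open      : ∀ {q} → L q → ∃[ r ] q < r × L r
    U-open      : ∀ {q} → U q → ∃[ r ] r < q × U r
    L-lower     : ∀ {q r} → q < r → L r → L q
    U-upper     : ∀ {q r} → q < r → U q → U r
    disjoint    : ∀ {q r} → L q → U r → q < r
    located     : ∀ {q r} → q < r → L q ⊎ U r

infix 4 _≤ℝ_ _<ℝ_

_≤ℝ_ : ℝ → ℝ → Set
x ≤ℝ y = ∀ q → ℝ.L x q → ℝ.L y q

_<ℝ_ : ℝ → ℝ → Set
x <ℝ y = ∃[ q ] ℝ.U x q × ℝ.L y q

fromℚ : ℚ → ℝ
fromℚ p = record
  { L           = _< p
  ; U           = p <_
  ; L-inhabited = p - 1ℚ , subst (p - 1ℚ <_) (+-identityʳ p)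
                             (+-monoʳ-< p (negative⁻¹ (- 1ℚ)))
  ; U-inhabited = p + 1ℚ , subst (_< p + 1ℚ) (+-identityʳ p)
                             (+-monoʳ-< p (positive⁻¹ 1ℚ))
  ; L-open      = <-dense
  ; U-open      = λ p<q → let r , p<r , r<q = <-dense p<q in r , r<q , p<r
  ; L-lower     = <-trans
  ; U-upper     = λ q<r p<q → <-trans p<q q<r
  ; disjoint    = <-trans
  ; located     = located
  }
  where
  located : ∀ {q r} → q < r → q < p ⊎ p < r
  located {q} q<r with q <? p
  ... | yes q<p = inj₁ q<p
  ... | no  q≮p = inj₂ (≤-<-trans (≮⇒≥ q≮p) q<r)

fromℤ : ℤ → ℝ
fromℤ b = fromℚ (b / 1)

-- The image of a real under an increasing bijection f of ℚ with inverse g.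

private
  image : (f g : ℚ → ℚ) →
          (∀ {q r} → q < r → f q < f r) → (∀ {q r} → q < r → g q < g r) →
          (∀ q → f (g q) ≡ q) → (∀ q → g (f q) ≡ q) → ℝ → ℝ
  image f g f-mono g-mono fg gf x = record
    { L           = λ q → L (g q)
    ; U           = λ q → U (g q)
    ; L-inhabited = let q , l = L-inhabited in f q , subst L (sym (gf q)) l
    ; U-inhabited = let q , u = U-inhabited in f q , subst U (sym (gf q)) u
    ; L-open      = λ {q} l → let r , q<r , l′ = L-open l in
                      f r , subst (_< f r) (fg q) (f-mono q<r)
                          , subst L (sym (gf r)) l′
    ; U-open      = λ {q} u → let r , r<q , u′ = U-open u in
                      f r , subst (f r <_) (fg q) (f-mono r<q)
                          , subst U (sym (gf r)) u′
    ; L-lower     = λ q<r → L-lower (g-mono q<r)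
    ; U-upper     = λ q<r → U-upper (g-mono q<r)
    ; disjoint    = λ {q} {r} l u →
                      subst₂ _<_ (fg q) (fg r) (f-mono (disjoint l u))
    ; located     = λ q<r → located (g-mono q<r)
    }
    where open ℝ x

infixl 6 _⊖_
infixr 7 ½·_

_⊖_ : ℝ → ℚ → ℝ
x ⊖ c = image (_- c) (_+ c) (+-monoˡ-< (- c)) (+-monoˡ-< c)
  (solve 2 (λ c q → q :+ c :- c := q) refl c)
  (solve 2 (λ c q → q :- c :+ c := q) refl c) x

½·_ : ℝ → ℝ
½·_ = image (½ *_) (λ q → q + q) (*-monoʳ-<-pos ½) (λ p → +-mono-< p p)
  (solve 1 (λ q → con ½ :* (q :+ q) := q) refl)
  (solve 1 (λ q → con ½ :* q :+ con ½ :* q := q) refl)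

------------------------------------------------------------------------
-- The nonnegative square root of a nonnegative rational

private
  *-mono-<-nonNeg : ∀ {x y} → 0ℚ ≤ x → x < y → x * x < y * y
  *-mono-<-nonNeg {x} {y} 0≤x x<y = ≤-<-trans
    (*-monoˡ-≤-nonNeg x {{nonNegative 0≤x}} (<⇒≤ x<y))
    (*-monoˡ-<-pos y {{positive (≤-<-trans 0≤x x<y)}} x<y)

  *-cancel-<-nonNeg : ∀ {x y} → 0ℚ ≤ y → x * x < y * y → x < y
  *-cancel-<-nonNeg {x} {y} 0≤y x²<y² with x <? y
  ... | yes x<y = x<y
  ... | no  x≮y = contradiction refl (λ eq → <-irrefl eq (<-≤-trans x²<y² (≤-trans
    (*-monoˡ-≤-nonNeg y {{nonNegative 0≤y}} y≤x)
    (*-monoʳ-≤-nonNeg x {{nonNegative (≤-trans 0≤y y≤x)}} y≤x))))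
    where y≤x = ≮⇒≥ x≮y

  p-q>0 : ∀ {p q} → q < p → 0ℚ < p - q
  p-q>0 {p} {q} q<p = subst (_< p - q) (+-inverseʳ q) (+-monoˡ-< (- q) q<p)

  p-q>0⇒q<p : ∀ {p q} → 0ℚ < p - q → q < p
  p-q>0⇒q<p {p} {q} 0<p-q = subst₂ _<_ (+-identityˡ q)
    (solve 2 (λ p q → p :- q :+ q := p) refl p q) (+-monoˡ-< q 0<p-q)

  *-pos : ∀ {p q} → 0ℚ < p → 0ℚ < q → 0ℚ < p * q
  *-pos {p} {q} 0<p 0<q = positive⁻¹ (p * q)
    {{pos*pos⇒pos p {{positive 0<p}} q {{positive 0<q}}}}

  +-pos : ∀ {p q} → 0ℚ ≤ p → 0ℚ < q → 0ℚ < p + q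
  +-pos = +-mono-≤-<

  +-nonNeg : ∀ {p q} → 0ℚ ≤ p → 0ℚ ≤ q → 0ℚ ≤ p + q
  +-nonNeg = +-mono-≤

  *-nonNeg : ∀ {p q} → 0ℚ ≤ p → 0ℚ ≤ q → 0ℚ ≤ p * q
  *-nonNeg {p} {q} 0≤p 0≤q = nonNegative⁻¹ (p * q)
    {{nonNeg*nonNeg⇒nonNeg p {{nonNegative 0≤p}} q {{nonNegative 0≤q}}}}

  -- For c > √q, the map x ↦ (cx + q) / (x + c) moves every x ≥ 0 strictly
  -- towards √q without crossing it.

  module Step (q x : ℚ) (0≤q : 0ℚ ≤ q) (0≤x : 0ℚ ≤ x) where

    c = q + 1ℚ

    0<c : 0ℚ < c
    0<c = +-pos 0≤q (positive⁻¹ 1ℚ)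

    0<x+c : 0ℚ < x + c
    0<x+c = +-pos 0≤x 0<c

    instance
      x+c-pos : Positive (x + c)
      x+c-pos = positive 0<x+c

      x+c-nonZero : NonZero (x + c)
      x+c-nonZero = pos⇒nonZero (x + c)

    r = 1/ (x + c)

    0<r : 0ℚ < r
    0<r = positive⁻¹ r {{1/pos⇒pos (x + c)}}

    y = (c * x + q) * r

    0≤y : 0ℚ ≤ y
    0≤y = *-nonNeg (+-nonNeg (*-nonNeg (<⇒≤ 0<c) 0≤x) 0≤q) (<⇒≤ 0<r)

    x≡ : x ≡ x * ((x + c) * r)
    x≡ = sym (trans (cong (x *_) (*-inverseʳ (x + c))) (*-identityʳ x))

    q≡ : q ≡ q * (((x + c) * r) * ((x + c) * r))
    q≡ = sym (trans
      (cong (q *_) (cong₂ _*_ (*-inverseʳ (x + c)) (*-inverseʳ (x + c))))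
      (*-identityʳ q))

    k = (q * q + q + 1ℚ) * (r * r)

    0<k : 0ℚ < k
    0<k = *-pos (+-pos (+-nonNeg (*-nonNeg 0≤q 0≤q) 0≤q) (positive⁻¹ 1ℚ))
                (*-pos 0<r 0<r)

    y-x : y - x ≡ (q - x * x) * r
    y-x = trans (cong (λ t → y - t) x≡)
      (solve 3 (λ q x r → let c = q :+ con 1ℚ in
        (c :* x :+ q) :* r :- x :* ((x :+ c) :* r) := (q :- x :* x) :* r)
        refl q x r)

    x-y : x - y ≡ (x * x - q) * r
    x-y = trans (cong (_- y) x≡)
      (solve 3 (λ q x r → let c = q :+ con 1ℚ in
        x :* ((x :+ c) :* r) :- (c :* x :+ q) :* r := (x :* x :- q) :* r)
        refl q x r)

    q-y² : q - y * y ≡ (q - x * x) * k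
    q-y² = trans (cong (_- y * y) q≡)
      (solve 3 (λ q x r → let c = q :+ con 1ℚ; y = (c :* x :+ q) :* r in
        q :* (((x :+ c) :* r) :* ((x :+ c) :* r)) :- y :* y :=
        (q :- x :* x) :* ((q :* q :+ q :+ con 1ℚ) :* (r :* r)))
        refl q x r)

    y²-q : y * y - q ≡ (x * x - q) * k
    y²-q = trans (cong (λ t → y * y - t) q≡)
      (solve 3 (λ q x r → let c = q :+ con 1ℚ; y = (c :* x :+ q) :* r in
        y :* y :- q :* (((x :+ c) :* r) :* ((x :+ c) :* r)) :=
        (x :* x :- q) :* ((q :* q :+ q :+ con 1ℚ) :* (r :* r)))
        refl q x r)

√ : (p : ℚ) → .{{NonNegative p}} → ℝ
√ p = record
  { L           = L
  ; U           = U
  ; L-inhabited = - 1ℚ , inj₁ (negative⁻¹ (- 1ℚ))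
  ; U-inhabited = p + 1ℚ , +-pos 0≤p (positive⁻¹ 1ℚ) , p<[p+1]²
  ; L-open      = L-open
  ; U-open      = U-open
  ; L-lower     = L-lower
  ; U-upper     = λ q<r (0<q , p<q²) → <-trans 0<q q<r ,
                    <-trans p<q² (*-mono-<-nonNeg (<⇒≤ 0<q) q<r)
  ; disjoint    = disjoint
  ; located     = located
  }
  where
  L U : Pred ℚ 0ℓ
  L q = q < 0ℚ ⊎ q * q < p
  U q = 0ℚ < q × p < q * q

  0≤p : 0ℚ ≤ p
  0≤p = nonNegative⁻¹ p

  p<[p+1]² : p < (p + 1ℚ) * (p + 1ℚ)
  p<[p+1]² = p-q>0⇒q<p (subst (0ℚ <_)
    (solve 1 (λ p → p :* p :+ p :+ con 1ℚ :=
                    (p :+ con 1ℚ) :* (p :+ con 1ℚ) :- p) refl p)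
    (+-pos (+-nonNeg (*-nonNeg 0≤p 0≤p) 0≤p) (positive⁻¹ 1ℚ)))

  L-open : ∀ {q} → L q → ∃[ r ] q < r × L r
  L-open {q} l with q <? 0ℚ | l
  ... | yes q<0 | _        = let r , q<r , r<0 = <-dense q<0 in r , q<r , inj₁ r<0
  ... | no  q≮0 | inj₁ q<0 = contradiction q<0 q≮0
  ... | no  q≮0 | inj₂ q²<p =
    y , p-q>0⇒q<p (subst (0ℚ <_) (sym y-x) (*-pos (p-q>0 q²<p) 0<r))
      , inj₂ (p-q>0⇒q<p (subst (0ℚ <_) (sym q-y²) (*-pos (p-q>0 q²<p) 0<k)))
    where open Step p q 0≤p (≮⇒≥ q≮0)

  U-open : ∀ {q} → U q → ∃[ r ] r < q × U r
  U-open {q} (0<q , p<q²) =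
    y , p-q>0⇒q<p (subst (0ℚ <_) (sym x-y) (*-pos (p-q>0 p<q²) 0<r))
      , *-cancel-<-nonNeg 0≤y (≤-<-trans 0≤p p<y²)
      , p<y²
    where
    open Step p q 0≤p (<⇒≤ 0<q)
    p<y² : p < y * y
    p<y² = p-q>0⇒q<p (subst (0ℚ <_) (sym y²-q) (*-pos (p-q>0 p<q²) 0<k))

  L-lower : ∀ {q r} → q < r → L r → L q
  L-lower q<r (inj₁ r<0) = inj₁ (<-trans q<r r<0)
  L-lower {q} q<r (inj₂ r²<p) with q <? 0ℚ
  ... | yes q<0 = inj₁ q<0
  ... | no  q≮0 = inj₂ (<-trans (*-mono-<-nonNeg (≮⇒≥ q≮0) q<r) r²<p)

  disjoint : ∀ {q r} → L q → U r → q < r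
  disjoint (inj₁ q<0)  (0<r , _)    = <-trans q<0 0<r
  disjoint (inj₂ q²<p) (0<r , p<r²) =
    *-cancel-<-nonNeg (<⇒≤ 0<r) (<-trans q²<p p<r²)

  located : ∀ {q r} → q < r → L q ⊎ U r
  located {q} q<r with q <? 0ℚ | q * q <? p
  ... | yes q<0 | _        = inj₁ (inj₁ q<0)
  ... | no  _   | yes q²<p = inj₁ (inj₂ q²<p)
  ... | no  q≮0 | no  q²≮p = inj₂
    ( ≤-<-trans (≮⇒≥ q≮0) q<r
    , ≤-<-trans (≮⇒≥ q²≮p) (*-mono-<-nonNeg (≮⇒≥ q≮0) q<r)
    )

------------------------------------------------------------------------
-- The two upper bounds

fromℕ : ℕ → ℚ
fromℕ n = + n / 1

private
  fromℕ-nonNeg : ∀ n → 0ℚ ≤ fromℕ n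
  fromℕ-nonNeg n = nonNegative⁻¹ (fromℕ n) {{normalize-nonNeg n 1}}

module _ (n₁ n₂ n₃ : ℕ) where

  private
    a₁ = fromℕ n₁
    a₂ = fromℕ n₂
    a₃ = fromℕ n₃

    0≤a₁ = fromℕ-nonNeg n₁
    0≤a₂ = fromℕ-nonNeg n₂
    0≤a₃ = fromℕ-nonNeg n₃

    0≤a₁+a₂+a₃ = +-nonNeg (+-nonNeg 0≤a₁ 0≤a₂) 0≤a₃

  radicand₁ radicand₂ : ℚ
  radicand₁ =
    (+ 1 / 3) * (a₁ + a₂ + a₃) * (a₁ + a₂ + a₃ + (+ 2 / 1) * a₁ * a₂ * a₃)
      + (+ 8 / 3) * (a₁ * a₂ + a₂ * a₃ + a₃ * a₁)
  radicand₂ = a₁ * a₂ * a₃ * (a₁ + a₂ + a₃)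

  instance
    radicand₁-nonNeg : NonNegative radicand₁
    radicand₁-nonNeg = nonNegative (+-nonNeg
      (*-nonNeg (*-nonNeg (nonNegative⁻¹ (+ 1 / 3)) 0≤a₁+a₂+a₃)
        (+-nonNeg 0≤a₁+a₂+a₃
          (*-nonNeg (*-nonNeg (*-nonNeg (nonNegative⁻¹ (+ 2 / 1)) 0≤a₁) 0≤a₂) 0≤a₃)))
      (*-nonNeg (nonNegative⁻¹ (+ 8 / 3))
        (+-nonNeg (+-nonNeg (*-nonNeg 0≤a₁ 0≤a₂) (*-nonNeg 0≤a₂ 0≤a₃))
          (*-nonNeg 0≤a₃ 0≤a₁))))

    radicand₂-nonNeg : NonNegative radicand₂
    radicand₂-nonNeg = nonNegative
      (*-nonNeg (*-nonNeg (*-nonNeg 0≤a₁ 0≤a₂) 0≤a₃) 0≤a₁+a₂+a₃)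

  ub₁ ub₂ : ℝ
  ub₁ = ½· (√ radicand₁ ⊖ a₁ ⊖ a₂ ⊖ a₃)
  ub₂ = ½· (√ radicand₂ ⊖ a₁ ⊖ a₂ ⊖ a₃)

UB₁ UB₂ : ∀ {m} → Vec ℕ (3 ℕ.+ m) → ℝ
UB₁ a = ub₁ (lookup a 0F) (lookup a 1F) (lookup a 2F)
UB₂ a = ub₂ (lookup a 0F) (lookup a 1F) (lookup a 2F)

-- Complete only for a₁ < a₂: if a₁ = a₂ = 1 then
-- radicand₁ - radicand₂ = 6 a₃ + 4 > 0, so ub₂ < ub₁ for every a₃.
-- At (1 , 2 , 25) the two bounds coincide.

exceptions : List (ℕ × ℕ × ℕ)
exceptions =
  (1 , 2 , 3)  ∷ (1 , 2 , 5)  ∷ (1 , 2 , 7)  ∷ (1 , 2 , 9)  ∷ (1 , 2 , 11) ∷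
  (1 , 2 , 13) ∷ (1 , 2 , 15) ∷ (1 , 2 , 17) ∷ (1 , 2 , 19) ∷ (1 , 2 , 21) ∷
  (1 , 2 , 23) ∷ (1 , 2 , 25) ∷ (1 , 3 , 4)  ∷ (1 , 3 , 5)  ∷ (1 , 3 , 7)  ∷
  (1 , 3 , 8)  ∷ (1 , 3 , 10) ∷ (1 , 3 , 11) ∷ (1 , 3 , 13) ∷ (1 , 3 , 14) ∷
  (1 , 4 , 5)  ∷ (1 , 4 , 7)  ∷ (1 , 4 , 9)  ∷ (1 , 4 , 11) ∷ (1 , 5 , 6)  ∷
  (1 , 5 , 7)  ∷ (1 , 5 , 8)  ∷ (1 , 5 , 9)  ∷ (1 , 6 , 7)  ∷ (2 , 3 , 5)  ∷ []

-- For a, b, c pairwise coprime, the pairs (x , y) with a ∣ b x + c y form a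
-- lattice of index a.  A Euclidean descent produces a basis adapted to the weights
-- b and c, and reducing along it moves every residue class into an L-shape.  So if
-- t is not a combination of a, b and c, then t + a + b + c is at most the value g
-- at one of the two outer corners of the L-shape.  Written in the six entries of
-- the reduced basis, the inequality
--   6 g² + e₁² + 2 e₂ ≤ e₁ e₃ + 6 g e₁
-- holds coefficientwise once every entry is at least 1.  If an entry vanishes, then
-- coprimality makes one generator a combination of the other two.  With n = 2 F + e₁
-- this gives 3 n² + 4 e₂ ≤ e₁² + 2 e₁ e₃, which is stronger than both bounds.

module Submission where

open import Defs
open import Data.Bool using (Bool; true; T; _∧_)
open import Data.Bool.Properties using (T-∧)
open import Data.Fin as Fin using (Fin)
open import Data.Fin.Patterns
open import Data.Integer as ℤ using (ℤ; -[1+_])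
import Data.Integer.Properties as ℤ
open import Data.List using (List; []; _∷_; map)
open import Data.List.Membership.Propositional using (_∈_)
open import Data.Nat
open import Data.Nat.Coprimality as Coprimality using (Coprime; coprime-Bézout; gcd≡1⇒coprime)
open import Data.Nat.Divisibility using (_∣_; n∣m*n; m∣m*n; ∣-refl; ∣m∣n⇒∣m+n)
open import Data.Nat.GCD using (gcd; module Bézout)
open import Data.Nat.Induction using (Acc; acc; <-wellFounded)
open import Data.Nat.Properties
open import Data.Nat.Tactic.RingSolver using (solve-∀)
open import Data.Product using (∃; ∃₂; ∃-syntax; _×_; _,_; proj₁; proj₂)
open import Data.Product.Properties using (≡-dec)
open import Data.Rational as ℚ using (ℚ; 0ℚ)
import Data.Rational.Properties as ℚ
open import Data.Rational.Solver using (module +-*-Solver)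
import Data.Rational.Unnormalised as ℚᵘ
import Data.Rational.Unnormalised.Properties as ℚᵘ
open import Data.Sum using (_⊎_; inj₁; inj₂; [_,_]′)
open import Data.Vec as Vec using (Vec; lookup; []; _∷_)
open import Function using (Equivalence; _∘_)
open import Relation.Binary.PropositionalEquality
open import Relation.Nullary using (Dec; yes; no; contradiction)
open import Relation.Nullary.Decidable using (_→-dec_; isYes; toWitness)

-- Coefficientwise comparison of polynomials with natural coefficients

data Expr (n : ℕ) : Set where
  con     : ℕ → Expr n
  var     : Fin n → Expr n
  _⊕_ _⊗_ : Expr n → Expr n → Expr n

infixl 6 _⊕_
infixl 7 _⊗_

⟦_⟧ : ∀ {n} → Expr n → Vec ℕ n → ℕ
⟦ con k ⟧ ρ = k
⟦ var i ⟧ ρ = lookup ρ i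
⟦ e ⊕ f ⟧ ρ = ⟦ e ⟧ ρ + ⟦ f ⟧ ρ
⟦ e ⊗ f ⟧ ρ = ⟦ e ⟧ ρ * ⟦ f ⟧ ρ

-- Dense recursive form: the coefficients of the first variable, lowest degree first. Trailing zeros
-- are not removed, so `_≤ᵖ_` admits a longer list on the left when its surplus coefficients are all
-- at most 0.
Poly : ℕ → Set
Poly zero    = ℕ
Poly (suc n) = List (Poly n)

eval : ∀ {n} → Poly n → Vec ℕ n → ℕ
eval {zero}  k        ρ       = k
eval {suc n} []       ρ       = 0
eval {suc n} (p ∷ ps) (x ∷ ρ) = eval p ρ + x * eval ps (x ∷ ρ)

conᵖ : ∀ {n} → ℕ → Poly n
conᵖ {zero}  k = k
conᵖ {suc n} k = conᵖ k ∷ []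

varᵖ : ∀ {n} → Fin n → Poly n
varᵖ 0F          = conᵖ 0 ∷ conᵖ 1 ∷ []
varᵖ (Fin.suc i) = varᵖ i ∷ []

_+ᵖ_ : ∀ {n} → Poly n → Poly n → Poly n
_+ᵖ_ {zero}  p        q        = p + q
_+ᵖ_ {suc n} []       qs       = qs
_+ᵖ_ {suc n} (p ∷ ps) []       = p ∷ ps
_+ᵖ_ {suc n} (p ∷ ps) (q ∷ qs) = (p +ᵖ q) ∷ (ps +ᵖ qs)

_*ᵖ_ : ∀ {n} → Poly n → Poly n → Poly n
_*ᵖ_ {zero}  p        q  = p * q
_*ᵖ_ {suc n} []       qs = []
_*ᵖ_ {suc n} (p ∷ ps) qs = map (p *ᵖ_) qs +ᵖ (conᵖ 0 ∷ (ps *ᵖ qs))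

_≤ᵖ_ : ∀ {n} → Poly n → Poly n → Bool
_≤ᵖ_ {zero}  p        q        = p ≤ᵇ q
_≤ᵖ_ {suc n} []       qs       = true
_≤ᵖ_ {suc n} (p ∷ ps) []       = (p ≤ᵖ conᵖ 0) ∧ (ps ≤ᵖ [])
_≤ᵖ_ {suc n} (p ∷ ps) (q ∷ qs) = (p ≤ᵖ q) ∧ (ps ≤ᵖ qs)

normalise : ∀ {n} → Expr n → Poly n
normalise (con k)  = conᵖ k
normalise (var i)  = varᵖ i
normalise (e ⊕ f) = normalise e +ᵖ normalise f
normalise (e ⊗ f) = normalise e *ᵖ normalise f

eval-con : ∀ {n} k (ρ : Vec ℕ n) → eval (conᵖ k) ρ ≡ k
eval-con k []      = refl
eval-con k (x ∷ ρ) =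
  trans (cong₂ _+_ (eval-con k ρ) (*-zeroʳ x)) (+-identityʳ k)

eval-var : ∀ {n} i (ρ : Vec ℕ n) → eval (varᵖ i) ρ ≡ lookup ρ i
eval-var 0F (x ∷ ρ) = begin
  eval (conᵖ 0) ρ + x * (eval (conᵖ 1) ρ + x * 0)
    ≡⟨ cong₂ (λ y z → y + x * (z + x * 0)) (eval-con 0 ρ) (eval-con 1 ρ) ⟩
  x * (1 + x * 0)
    ≡⟨ lemma x ⟩
  x ∎
  where
  open ≡-Reasoning
  lemma : ∀ x → x * (1 + x * 0) ≡ x
  lemma = solve-∀
eval-var (Fin.suc i) (x ∷ ρ) =
  trans (cong₂ _+_ (eval-var i ρ) (*-zeroʳ x)) (+-identityʳ _)

eval-+ : ∀ {n} (p q : Poly n) ρ → eval (p +ᵖ q) ρ ≡ eval p ρ + eval q ρ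
eval-+ {zero}  p        q        ρ       = refl
eval-+ {suc n} []       qs       ρ       = refl
eval-+ {suc n} (p ∷ ps) []       ρ       = sym (+-identityʳ _)
eval-+ {suc n} (p ∷ ps) (q ∷ qs) (x ∷ ρ) =
  trans (cong₂ (λ y z → y + x * z) (eval-+ p q ρ) (eval-+ ps qs (x ∷ ρ)))
        (lemma (eval p ρ) (eval q ρ) x (eval ps (x ∷ ρ)) (eval qs (x ∷ ρ)))
  where
  lemma : ∀ p q x r s → p + q + x * (r + s) ≡ p + x * r + (q + x * s)
  lemma = solve-∀

mutual
  eval-* : ∀ {n} (p q : Poly n) ρ → eval (p *ᵖ q) ρ ≡ eval p ρ * eval q ρ
  eval-* {zero}  p        q  ρ       = refl
  eval-* {suc n} []       qs ρ       = refl
  eval-* {suc n} (p ∷ ps) qs (x ∷ ρ) = begin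
    eval (map (p *ᵖ_) qs +ᵖ (conᵖ 0 ∷ (ps *ᵖ qs))) (x ∷ ρ)
      ≡⟨ eval-+ (map (p *ᵖ_) qs) _ (x ∷ ρ) ⟩
    eval (map (p *ᵖ_) qs) (x ∷ ρ) + (eval (conᵖ 0) ρ + x * eval (ps *ᵖ qs) (x ∷ ρ))
      ≡⟨ cong₂ _+_ (eval-map-* p qs x ρ)
           (cong₂ (λ y z → y + x * z) (eval-con 0 ρ) (eval-* ps qs (x ∷ ρ))) ⟩
    eval p ρ * Q + x * (eval ps (x ∷ ρ) * Q)
      ≡⟨ lemma (eval p ρ) x (eval ps (x ∷ ρ)) Q ⟩
    (eval p ρ + x * eval ps (x ∷ ρ)) * Q ∎
    where
    open ≡-Reasoning
    Q = eval qs (x ∷ ρ)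
    lemma : ∀ p x r q → p * q + x * (r * q) ≡ (p + x * r) * q
    lemma = solve-∀

  eval-map-* : ∀ {n} (p : Poly n) qs x ρ →
    eval {suc n} (map (p *ᵖ_) qs) (x ∷ ρ) ≡ eval p ρ * eval qs (x ∷ ρ)
  eval-map-* p []       x ρ = sym (*-zeroʳ (eval p ρ))
  eval-map-* p (q ∷ qs) x ρ =
    trans (cong₂ (λ y z → y + x * z) (eval-* p q ρ) (eval-map-* p qs x ρ))
          (lemma (eval p ρ) (eval q ρ) x (eval qs (x ∷ ρ)))
    where
    lemma : ∀ p q x r → p * q + x * (p * r) ≡ p * (q + x * r)
    lemma = solve-∀

eval-≤ : ∀ {n} (p q : Poly n) → T (p ≤ᵖ q) → ∀ ρ → eval p ρ ≤ eval q ρ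
eval-≤ {zero}  p        q        p≤q ρ       = ≤ᵇ⇒≤ p q p≤q
eval-≤ {suc n} []       qs       p≤q ρ       = z≤n
eval-≤ {suc n} (p ∷ ps) []       p≤q (x ∷ ρ) = begin
  eval p ρ + x * eval ps (x ∷ ρ)
    ≤⟨ +-mono-≤ (eval-≤ p (conᵖ 0) (proj₁ h) ρ)
                (*-monoʳ-≤ x (eval-≤ ps [] (proj₂ h) (x ∷ ρ))) ⟩
  eval (conᵖ 0) ρ + x * 0
    ≡⟨ cong₂ _+_ (eval-con 0 ρ) (*-zeroʳ x) ⟩
  0 ∎
  where
  open ≤-Reasoning
  h = Equivalence.to T-∧ p≤q
eval-≤ {suc n} (p ∷ ps) (q ∷ qs) p≤q (x ∷ ρ) =
  +-mono-≤ (eval-≤ p q (proj₁ h) ρ) (*-monoʳ-≤ x (eval-≤ ps qs (proj₂ h) (x ∷ ρ)))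
  where h = Equivalence.to T-∧ p≤q

eval-normalise : ∀ {n} (e : Expr n) ρ → eval (normalise e) ρ ≡ ⟦ e ⟧ ρ
eval-normalise (con k)  ρ = eval-con k ρ
eval-normalise (var i)  ρ = eval-var i ρ
eval-normalise (e ⊕ f) ρ = trans (eval-+ (normalise e) (normalise f) ρ)
  (cong₂ _+_ (eval-normalise e ρ) (eval-normalise f ρ))
eval-normalise (e ⊗ f) ρ = trans (eval-* (normalise e) (normalise f) ρ)
  (cong₂ _*_ (eval-normalise e ρ) (eval-normalise f ρ))

-- Sound because the variables range over ℕ, where every monomial is nonnegative. For closed
-- expressions the test evaluates to `true`, so its proof can be written `_`.
coefficientwise-≤ : ∀ {n} (e f : Expr n) → T (normalise e ≤ᵖ normalise f) →
                    ∀ ρ → ⟦ e ⟧ ρ ≤ ⟦ f ⟧ ρ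
coefficientwise-≤ e f e≤f ρ =
  subst₂ _≤_ (eval-normalise e ρ) (eval-normalise f ρ)
    (eval-≤ (normalise e) (normalise f) e≤f ρ)

-- Elementary symmetric functions and the quadratic inequality

e₁ e₂ e₃ : ℕ → ℕ → ℕ → ℕ
e₁ a b c = a + b + c
e₂ a b c = a * b + b * c + c * a
e₃ a b c = a * b * c

e₁ᵉ e₂ᵉ e₃ᵉ : ∀ {n} → Expr n → Expr n → Expr n → Expr n
e₁ᵉ a b c = a ⊕ b ⊕ c
e₂ᵉ a b c = a ⊗ b ⊕ b ⊗ c ⊕ c ⊗ a
e₃ᵉ a b c = a ⊗ b ⊗ c

quadraticˡ quadraticʳ : ∀ {n} → Expr n → Expr n → Expr n → Expr n → Expr n
quadraticˡ a b c g = con 6 ⊗ (g ⊗ g) ⊕ e₁ᵉ a b c ⊗ e₁ᵉ a b c ⊕ con 2 ⊗ e₂ᵉ a b c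
quadraticʳ a b c g = e₁ᵉ a b c ⊗ e₃ᵉ a b c ⊕ con 6 ⊗ (g ⊗ e₁ᵉ a b c)

-- Substituting 1 + x for a variable turns an inequality on entries at least 1 into one that can
-- hold coefficientwise.
sucᵉ : ∀ {n} → Fin n → Expr n
sucᵉ i = con 1 ⊕ var i

Quadratic : ℕ → ℕ → ℕ → ℕ → Set
Quadratic a b c g =
  6 * (g * g) + e₁ a b c * e₁ a b c + 2 * e₂ a b c ≤
  e₁ a b c * e₃ a b c + 6 * (g * e₁ a b c)

quadratic-generic : ∀ s p α β u w →
  let s = suc s ; p = suc p; α = suc α; β = suc β; u = suc u; w = suc w
      a = s * β + α * p + α * β
      b = u * (p + β) + w * p
      c = u * s + w * (s + α)
  in Quadratic a b c (b * α + c * (p + β))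
quadratic-generic s p α β u w = coefficientwise-≤
  (quadraticˡ a b c g) (quadraticʳ a b c g) _ (s ∷ p ∷ α ∷ β ∷ u ∷ w ∷ [])
  where
  s′ = sucᵉ 0F; p′ = sucᵉ 1F; α′ = sucᵉ 2F; β′ = sucᵉ 3F; u′ = sucᵉ 4F; w′ = sucᵉ 5F
  a b c g : Expr 6
  a = s′ ⊗ β′ ⊕ α′ ⊗ p′ ⊕ α′ ⊗ β′
  b = u′ ⊗ (p′ ⊕ β′) ⊕ w′ ⊗ p′
  c = u′ ⊗ s′ ⊕ w′ ⊗ (s′ ⊕ α′)
  g = b ⊗ α′ ⊕ c ⊗ (p′ ⊕ β′)

-- The last argument is `e₁` - 1 for the incremented entries, the value of t + `e₁` at t = -1.
quadratic-trivial : ∀ a b c → Quadratic (suc a) (suc b) (suc c) (2 + (a + b + c))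
quadratic-trivial a b c = coefficientwise-≤
  (quadraticˡ a′ b′ c′ g) (quadraticʳ a′ b′ c′ g) _ (a ∷ b ∷ c ∷ [])
  where
  a′ b′ c′ g : Expr 3
  a′ = sucᵉ 0F; b′ = sucᵉ 1F; c′ = sucᵉ 2F
  g = con 2 ⊕ (var 0F ⊕ var 1F ⊕ var 2F)

quadratic-two : ∀ i j k →
  let x = 2 + i; y = x + j; z = x + y + k in Quadratic x y z (x * y + z)
quadratic-two i j k = coefficientwise-≤
  (quadraticˡ x y z g) (quadraticʳ x y z g) _ (i ∷ j ∷ k ∷ [])
  where
  x y z g : Expr 3
  x = con 2 ⊕ var 0F; y = x ⊕ var 1F; z = x ⊕ y ⊕ var 2F
  g = x ⊗ y ⊕ z

-- `Quadratic` may fail when g decreases, since g also occurs on the right. Quantifying over every n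
-- up to 2 g - `e₁` gives a property that passes to smaller g.
record Bounds (a b c g : ℕ) : Set where
  constructor bounds
  field
    bound : ∀ n → n + e₁ a b c ≤ 2 * g →
      3 * (n * n) + 4 * e₂ a b c ≤ e₁ a b c * e₁ a b c + 2 * (e₁ a b c * e₃ a b c)

bounds-antitone : ∀ {a b c g h} → g ≤ h → Bounds a b c h → Bounds a b c g
bounds-antitone g≤h (bounds bd) =
  bounds λ n n≤ → bd n (≤-trans n≤ (*-monoʳ-≤ 2 g≤h))

-- At N = 2 g - s the claim is twice `Quadratic`, rearranged; smaller n follow by monotonicity.
-- Adding 6 N s + 5 s² to both sides completes 3 N² to 3 (N + s)² + 2 s², where N + s = 2 g can be
-- substituted without subtraction.
quadratic⇒bounds : ∀ a b c g → Quadratic a b c g → Bounds a b c g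
quadratic⇒bounds a b c g q = bounds λ n n+s≤2g → let 
        n≤N    = m+n≤o⇒m≤o∸n n n+s≤2g
        N+s≡2g = m∸n+n≡m {2 * g} (≤-trans (m≤n+m s n) n+s≤2g)
      in +-cancelʳ-≤ (6 * (N * s) + 5 * (s * s)) _ _ (begin
  3 * (n * n) + 4 * t + (6 * (N * s) + 5 * (s * s))
    ≤⟨ +-monoˡ-≤ _ (+-monoˡ-≤ _ (*-monoʳ-≤ 3 (*-mono-≤ n≤N n≤N))) ⟩
  3 * (N * N) + 4 * t + (6 * (N * s) + 5 * (s * s))
    ≡⟨ lemma₁ N s t ⟩
  3 * ((N + s) * (N + s)) + 2 * (s * s) + 4 * t
    ≡⟨ cong (λ z → 3 * (z * z) + 2 * (s * s) + 4 * t) N+s≡2g ⟩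
  3 * (2 * g * (2 * g)) + 2 * (s * s) + 4 * t
    ≡⟨ lemma₂ g s t ⟩
  2 * (6 * (g * g) + s * s + 2 * t)
    ≤⟨ *-monoʳ-≤ 2 q ⟩
  2 * (s * r + 6 * (g * s))
    ≡⟨ lemma₃ g s r ⟩
  2 * (s * r) + 6 * (2 * g * s)
    ≡⟨ cong (λ z → 2 * (s * r) + 6 * (z * s)) N+s≡2g ⟨
  2 * (s * r) + 6 * ((N + s) * s)
    ≡⟨ lemma₄ N s r ⟩
  s * s + 2 * (s * r) + (6 * (N * s) + 5 * (s * s)) ∎)
  where
  open ≤-Reasoning
  s = e₁ a b c
  t = e₂ a b c
  r = e₃ a b c
  N = 2 * g ∸ s
  lemma₁ : ∀ N s t → 3 * (N * N) + 4 * t + (6 * (N * s) + 5 * (s * s)) ≡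
                     3 * ((N + s) * (N + s)) + 2 * (s * s) + 4 * t
  lemma₁ = solve-∀
  lemma₂ : ∀ g s t → 3 * (2 * g * (2 * g)) + 2 * (s * s) + 4 * t ≡
                     2 * (6 * (g * g) + s * s + 2 * t)
  lemma₂ = solve-∀
  lemma₃ : ∀ g s r → 2 * (s * r + 6 * (g * s)) ≡ 2 * (s * r) + 6 * (2 * g * s)
  lemma₃ = solve-∀
  lemma₄ : ∀ N s r → 2 * (s * r) + 6 * ((N + s) * s) ≡
                     s * s + 2 * (s * r) + (6 * (N * s) + 5 * (s * s))
  lemma₄ = solve-∀

bounds-cong : ∀ {a b c a′ b′ c′ g} → e₁ a b c ≡ e₁ a′ b′ c′ →
  e₂ a b c ≡ e₂ a′ b′ c′ → e₃ a b c ≡ e₃ a′ b′ c′ →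
  Bounds a b c g → Bounds a′ b′ c′ g
bounds-cong {g = g} eq₁ eq₂ eq₃ (bounds bd) = bounds λ n → subst₂
  (λ s (t , r) → n + s ≤ 2 * g → 3 * (n * n) + 4 * t ≤ s * s + 2 * (s * r))
  eq₁ (cong₂ _,_ eq₂ eq₃) (bd n)

bounds-swap : ∀ a b c {g} → Bounds a b c g → Bounds b a c g
bounds-swap a b c = bounds-cong (lemma₁ a b c) (lemma₂ a b c) (lemma₃ a b c)
  where
  lemma₁ : ∀ a b c → a + b + c ≡ b + a + c
  lemma₁ = solve-∀
  lemma₂ : ∀ a b c → a * b + b * c + c * a ≡ b * a + a * c + c * b
  lemma₂ = solve-∀
  lemma₃ : ∀ a b c → a * b * c ≡ b * a * c
  lemma₃ = solve-∀

bounds-rotate : ∀ a b c {g} → Bounds a b c g → Bounds b c a g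
bounds-rotate a b c = bounds-cong (lemma₁ a b c) (lemma₂ a b c) (lemma₃ a b c)
  where
  lemma₁ : ∀ a b c → a + b + c ≡ b + c + a
  lemma₁ = solve-∀
  lemma₂ : ∀ a b c → a * b + b * c + c * a ≡ b * c + c * a + a * b
  lemma₂ = solve-∀
  lemma₃ : ∀ a b c → a * b * c ≡ b * c * a
  lemma₃ = solve-∀

bounds-trivial : ∀ {a b c g} → 0 < a → 0 < b → 0 < c → g < e₁ a b c → Bounds a b c g
bounds-trivial {suc a} {suc b} {suc c} {g} (s≤s _) (s≤s _) (s≤s _) g<s =
  bounds-antitone (s≤s⁻¹ (subst (g <_) (lemma a b c) g<s))
    (quadratic⇒bounds (suc a) (suc b) (suc c) _ (quadratic-trivial a b c))
  where
  lemma : ∀ a b c → e₁ (suc a) (suc b) (suc c) ≡ 3 + (a + b + c)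
  lemma a b c = cong suc
    (trans (+-suc (a + suc b) c) (cong (λ t → suc (t + c)) (+-suc a b)))

bounds-two : ∀ {x y z} → 1 < x → x ≤ y → x + y ≤ z → Bounds x y z (x * y + z)
bounds-two {suc (suc i)} (s≤s (s≤s _)) x≤y x+y≤z
  with j , refl ← m≤n⇒∃[o]m+o≡n x≤y
  with k , refl ← m≤n⇒∃[o]m+o≡n x+y≤z
  = quadratic⇒bounds _ _ _ _ (quadratic-two i j k)

-- For coprime x and y, x y - x - y is the Frobenius number of the pair, and adding `e₁` gives x y +
-- z. If x or y is 1, this is `e₁` - 1. Otherwise i = 0 or j = 0 would make y or x divide z, so both
-- are positive and x + y ≤ z.
bounds-combination : ∀ {x y z} → 0 < x → 0 < y → 0 < z → Coprime z x → Coprime z y →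
  ∀ i j → z ≡ i * x + j * y → Bounds x y z (x * y + z)
bounds-combination {1} {y} {z} 0<x 0<y 0<z z⊥x z⊥y i j z≡ =
  bounds-trivial 0<x 0<y 0<z (≤-reflexive (cong (λ t → suc (t + z)) (*-identityˡ y)))
bounds-combination {x} {1} {z} 0<x 0<y 0<z z⊥x z⊥y i j z≡ =
  bounds-trivial 0<x 0<y 0<z (≤-reflexive (lemma x z))
  where
  lemma : ∀ x z → suc (x * 1 + z) ≡ x + 1 + z
  lemma = solve-∀
bounds-combination {suc (suc x)} {suc (suc y)} 0<x 0<y 0<z z⊥x z⊥y zero j z≡
  with () ← z⊥y (subst (suc (suc y) ∣_) (sym z≡) (n∣m*n j) , ∣-refl)
bounds-combination {suc (suc x)} {suc (suc y)} 0<x 0<y 0<z z⊥x z⊥y (suc i) zero z≡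
  with () ← z⊥x (subst (suc (suc x) ∣_) (sym (trans z≡ (+-identityʳ _))) (n∣m*n (suc i)) ,
                 ∣-refl)
bounds-combination {x@(suc (suc _))} {y@(suc (suc _))} {z} 0<x 0<y 0<z z⊥x z⊥y (suc i) (suc j) z≡ =
  [ (λ x≤y → bounds-two (s≤s (s≤s z≤n)) x≤y x+y≤z)
  , (λ y≤x → subst (λ t → Bounds x y z (t + z)) (*-comm y x)
      (bounds-swap y x z (bounds-two (s≤s (s≤s z≤n)) y≤x (subst (_≤ z) (+-comm x y) x+y≤z))))
  ]′ (≤-total x y)
  where
  x+y≤z : x + y ≤ z
  x+y≤z = subst (x + y ≤_) (sym z≡) (+-mono-≤ (m≤m+n x (i * x)) (m≤m+n y (j * y)))

-- Euclidean reduction of a lattice basis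

-- The rows (s , − p , u) and (α , β , v) span the integer relations
-- b x + c y = a z, since their cross product is (b , c , − a) up to sign.

record Basis (a b c : ℕ) : Set where
  field
    s p u α β v : ℕ
    0<u : 0 < u
    0<α : 0 < α
    0<β : 0 < β
    a≡ : a ≡ s * β + α * p
    b≡ : b ≡ u * β + v * p
    c≡ : c + u * α ≡ s * v

  0<s : 0 < c → 0 < s
  0<s 0<c = n≢0⇒n>0 λ s≡0 →
    <-irrefl (sym (m+n≡0⇒m≡0 c (trans c≡ (cong (_* v) s≡0)))) 0<c

-- Here `s` and `w` stand for s - α and v - u of a `Basis`. The rows are (s + α , - p , u) and (α ,
-- β , u + w), and the second minus the first is (- s , p + β , w).
record ReducedBasis (a b c : ℕ) : Set where
  field
    s p u α β w : ℕ
    0<u : 0 < u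
    0<α : 0 < α
    0<β : 0 < β
    a≡ : a ≡ s * β + α * p + α * β
    b≡ : b ≡ u * (p + β) + w * p
    c≡ : c ≡ u * s + w * (s + α)

<⇒∃+ : ∀ {m n} → m < n → ∃[ o ] 0 < o × n ≡ m + o
<⇒∃+ {m} m<n with o , refl ← m≤n⇒∃[o]m+o≡n m<n = suc o , s≤s z≤n , sym (+-suc m o)

-- Subtractive Euclid on (s , α). If s < α, the first row is subtracted from the second, and c + u α
-- = s v forces u ≤ v. If α ≤ s and v < u, the second is subtracted from the first. Either way s + α
-- drops by a positive amount; the descent stops at α ≤ s and u ≤ v.
reduce : ∀ {a b c} → 0 < c → (B : Basis a b c) →
         Acc _<_ (Basis.s B + Basis.α B) → ReducedBasis a b c
reduce {a} {b} {c} 0<c B (acc rec) with Basis.s B <? Basis.α B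
... | yes s<α = reduce 0<c B′ (rec smaller)
  where
  open Basis B
  instance _ = >-nonZero (0<s 0<c)
  lemma-a : ∀ s p α β → s * β + (s + α) * p ≡ s * (β + p) + α * p
  lemma-a = solve-∀
  lemma-b : ∀ p u β v → u * β + (u + v) * p ≡ u * (β + p) + v * p
  lemma-b = solve-∀
  lemma-c : ∀ c s u α → c + u * α + s * u ≡ c + u * (s + α)
  lemma-c = solve-∀
  lemma-s : ∀ s u v → s * (u + v) ≡ s * v + s * u
  lemma-s = solve-∀
  α′   = proj₁ (<⇒∃+ s<α)
  0<α′ = proj₁ (proj₂ (<⇒∃+ s<α))
  α≡   = proj₂ (proj₂ (<⇒∃+ s<α))
  u≤v : u ≤ v
  u≤v = *-cancelˡ-≤ s (begin
    s * u          ≡⟨ *-comm s u ⟩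
    u * s          ≤⟨ *-monoʳ-≤ u (<⇒≤ s<α) ⟩
    u * α          ≤⟨ m≤n+m (u * α) c ⟩
    c + u * α      ≡⟨ c≡ ⟩
    s * v          ∎)
    where open ≤-Reasoning
  v′ = v ∸ u
  v≡ : v ≡ u + v′
  v≡ = sym (m+[n∸m]≡n u≤v)
  B′ : Basis a b c
  B′ = record
    { s = s; p = p; u = u; α = α′; β = β + p; v = v′
    ; 0<u = 0<u; 0<α = 0<α′; 0<β = ≤-trans 0<β (m≤m+n β p)
    ; a≡ = trans a≡ (trans (cong (λ t → s * β + t * p) α≡) (lemma-a s p α′ β))
    ; b≡ = trans b≡ (trans (cong (λ t → u * β + t * p) v≡) (lemma-b p u β v′))
    ; c≡ = +-cancelʳ-≡ (s * u) _ _ (begin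
        c + u * α′ + s * u    ≡⟨ lemma-c c s u α′ ⟩
        c + u * (s + α′)      ≡⟨ cong (λ t → c + u * t) α≡ ⟨
        c + u * α             ≡⟨ c≡ ⟩
        s * v                 ≡⟨ cong (s *_) v≡ ⟩
        s * (u + v′)          ≡⟨ lemma-s s u v′ ⟩
        s * v′ + s * u        ∎)
    }
    where open ≡-Reasoning
  smaller : s + α′ < s + α
  smaller = +-monoʳ-< s (subst (α′ <_) (sym α≡) (+-monoˡ-≤ α′ (0<s 0<c)))
... | no s≮α with Basis.v B <? Basis.u B
...   | yes v<u = reduce 0<c B′ (rec smaller)
  where
  open Basis B
  lemma-a : ∀ s p α β → (α + s) * β + α * p ≡ s * β + α * (p + β)
  lemma-a = solve-∀
  lemma-b : ∀ p u β v → (v + u) * β + v * p ≡ u * β + v * (p + β)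
  lemma-b = solve-∀
  lemma-c : ∀ c u α v → c + u * α + α * v ≡ c + (v + u) * α
  lemma-c = solve-∀
  lemma-s : ∀ s α v → (α + s) * v ≡ s * v + α * v
  lemma-s = solve-∀
  u′   = proj₁ (<⇒∃+ v<u)
  0<u′ = proj₁ (proj₂ (<⇒∃+ v<u))
  u≡   = proj₂ (proj₂ (<⇒∃+ v<u))
  s′ = s ∸ α
  s≡ : s ≡ α + s′
  s≡ = sym (m+[n∸m]≡n (≮⇒≥ s≮α))
  B′ : Basis a b c
  B′ = record
    { s = s′; p = p + β; u = u′; α = α; β = β; v = v
    ; 0<u = 0<u′; 0<α = 0<α; 0<β = 0<β
    ; a≡ = trans a≡ (trans (cong (λ t → t * β + α * p) s≡) (lemma-a s′ p α β))
    ; b≡ = trans b≡ (trans (cong (λ t → t * β + v * p) u≡) (lemma-b p u′ β v))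
    ; c≡ = +-cancelʳ-≡ (α * v) _ _ (begin
        c + u′ * α + α * v    ≡⟨ lemma-c c u′ α v ⟩
        c + (v + u′) * α      ≡⟨ cong (λ t → c + t * α) u≡ ⟨
        c + u * α             ≡⟨ c≡ ⟩
        s * v                 ≡⟨ cong (_* v) s≡ ⟩
        (α + s′) * v          ≡⟨ lemma-s s′ α v ⟩
        s′ * v + α * v        ∎)
    }
    where open ≡-Reasoning
  smaller : s′ + α < s + α
  smaller = +-monoˡ-< α (subst (s′ <_) (sym s≡) (+-monoˡ-≤ s′ 0<α))
...   | no v≮u = record
  { s = s′; p = p; u = u; α = α; β = β; w = w
  ; 0<u = 0<u; 0<α = 0<α; 0<β = 0<β
  ; a≡ = trans a≡ (trans (cong (λ t → t * β + α * p) s≡) (lemma-a s′ p α β))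
  ; b≡ = trans b≡ (trans (cong (λ t → u * β + t * p) v≡) (lemma-b p u β w))
  ; c≡ = +-cancelʳ-≡ (u * α) _ _ (begin
      c + u * α                          ≡⟨ c≡ ⟩
      s * v                              ≡⟨ cong₂ _*_ s≡ v≡ ⟩
      (α + s′) * (u + w)                 ≡⟨ lemma-c s′ u α w ⟩
      u * s′ + w * (s′ + α) + u * α      ∎)
  }
  where
  open Basis B
  open ≡-Reasoning
  lemma-a : ∀ s p α β → (α + s) * β + α * p ≡ s * β + α * p + α * β
  lemma-a = solve-∀
  lemma-b : ∀ p u β w → u * β + (u + w) * p ≡ u * (p + β) + w * p
  lemma-b = solve-∀
  lemma-c : ∀ s u α w → (α + s) * (u + w) ≡ u * s + w * (s + α) + u * α
  lemma-c = solve-∀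
  s′ = s ∸ α
  s≡ : s ≡ α + s′
  s≡ = sym (m+[n∸m]≡n (≮⇒≥ s≮α))
  w = v ∸ u
  v≡ : v ≡ u + w
  v≡ = sym (m+[n∸m]≡n (≮⇒≥ v≮u))

-- Bézout relations over ℕ and the starting basis

coprime⇒solvable : ∀ {a b} → 0 < a → 0 < b → Coprime b a →
                   ∀ r → ∃₂ λ k x → r + a * k ≡ b * x
coprime⇒solvable {suc a} {suc b} _ _ b⊥a r with coprime-Bézout b⊥a
... | Bézout.+- x y eq = r * y , r * x , (begin
  r + suc a * (r * y)      ≡⟨ lemma₁ r (suc a) y ⟩
  r * (1 + y * suc a)      ≡⟨ cong (r *_) eq ⟩
  r * (x * suc b)          ≡⟨ lemma₂ r x (suc b) ⟩
  suc b * (r * x)          ∎)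
  where
  open ≡-Reasoning
  lemma₁ : ∀ r a y → r + a * (r * y) ≡ r * (1 + y * a)
  lemma₁ = solve-∀
  lemma₂ : ∀ r x b → r * (x * b) ≡ b * (r * x)
  lemma₂ = solve-∀
-- The identity has the wrong sign. Multiplying it by a, which is -1 modulo `suc a`, reverses the
-- sign, and adding the product of `suc a` and `suc b` to both sides avoids subtraction.
... | Bézout.-+ x (suc y) eq = r * (a * y + a + b) , r * (x * a + (1 + a)) , (begin
  r + (1 + a) * (r * (a * y + a + b))      ≡⟨ lemma₁ a b r y ⟩
  r * ((a + y * (1 + a)) * a + (1 + b) * (1 + a))
    ≡⟨ cong (λ t → r * (t * a + (1 + b) * (1 + a))) (suc-injective eq) ⟨
  r * (x * (1 + b) * a + (1 + b) * (1 + a)) ≡⟨ lemma₂ a b r x ⟩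
  (1 + b) * (r * (x * a + (1 + a)))        ∎)
  where
  open ≡-Reasoning
  lemma₁ : ∀ a b r y → r + (1 + a) * (r * (a * y + a + b)) ≡
                       r * ((a + y * (1 + a)) * a + (1 + b) * (1 + a))
  lemma₁ = solve-∀
  lemma₂ : ∀ a b r x → r * (x * (1 + b) * a + (1 + b) * (1 + a)) ≡
                       (1 + b) * (r * (x * a + (1 + a)))
  lemma₂ = solve-∀

-- The first row is the trivial relation b a = a b. The second is a solution of c + b k = a x, plus
-- the first row so that α is positive.
initialBasis : ∀ {a b c} → 0 < a → 0 < b → Coprime a b → Basis a b c
initialBasis {a} {b} {c} 0<a 0<b a⊥b = record
  { s = a; p = 0; u = b; α = k + a; β = 1; v = x + b
  ; 0<u = 0<b; 0<α = ≤-trans 0<a (m≤n+m a k); 0<β = s≤s z≤n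
  ; a≡ = lemma₁ a (k + a)
  ; b≡ = lemma₁ b (x + b)
  ; c≡ = trans (lemma₂ a b c k) (trans (cong (_+ a * b) eq) (sym (*-distribˡ-+ a x b)))
  }
  where
  solution = coprime⇒solvable 0<b 0<a a⊥b c
  k  = proj₁ solution
  x  = proj₁ (proj₂ solution)
  eq = proj₂ (proj₂ solution)
  lemma₁ : ∀ m n → m ≡ m * 1 + n * 0
  lemma₁ = solve-∀
  lemma₂ : ∀ a b c k → c + b * (k + a) ≡ c + b * k + a * b
  lemma₂ = solve-∀

reducedBasis : ∀ {a b c} → 0 < a → 0 < b → 0 < c → Coprime a b → ReducedBasis a b c
reducedBasis 0<a 0<b 0<c a⊥b = reduce 0<c (initialBasis 0<a 0<b a⊥b) (<-wellFounded _)

-- Descent into the L-shape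

Combination : ℕ → ℕ → ℕ → ℕ → Set
Combination a b c t = ∃ λ x → ∃ λ y → ∃ λ z → t ≡ a * x + b * y + c * z

module _ {a b c} (R : ReducedBasis a b c) where
  open ReducedBasis R

  -- The L-shape is the rectangle x < s + α, y < p + β without its part x ≥ α, y ≥ β; its area is a.
  -- These are the values of b x + c y at the outer corners (α , p + β) and (s + α , β).
  g₁ g₂ : ℕ
  g₁ = b * α + c * (p + β)
  g₂ = b * (s + α) + c * β

  -- The three relations give the lattice vectors (s + α , - p), (- s , p + β) and (α , β).
  -- Subtracting one from (x , y) releases u, w or u + w copies of a.
  relation₁ : b * (s + α) ≡ c * p + a * u
  relation₁ rewrite a≡ | b≡ | c≡ = lemma s p u α β w
    where
    lemma : ∀ s p u α β w → (u * (p + β) + w * p) * (s + α) ≡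
      (u * s + w * (s + α)) * p + (s * β + α * p + α * β) * u
    lemma = solve-∀

  relation₂ : c * (p + β) ≡ b * s + a * w
  relation₂ rewrite a≡ | b≡ | c≡ = lemma s p u α β w
    where
    lemma : ∀ s p u α β w → (u * s + w * (s + α)) * (p + β) ≡
      (u * (p + β) + w * p) * s + (s * β + α * p + α * β) * w
    lemma = solve-∀

  relation₃ : b * α + c * β ≡ a * (u + w)
  relation₃ rewrite a≡ | b≡ | c≡ = lemma s p u α β w
    where
    lemma : ∀ s p u α β w → (u * (p + β) + w * p) * α + (u * s + w * (s + α)) * β ≡
      (s * β + α * p + α * β) * (u + w)
    lemma = solve-∀

  Outcome : ℕ → Set
  Outcome t = Combination a b c t ⊎ t + e₁ a b c ≤ g₁ ⊎ t + e₁ a b c ≤ g₂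

  -- If b x + c y = t + a k with k > 0, then either (x , y) can be moved along a
  -- lattice vector, which decreases (k , y) lexicographically, or it lies in an
  -- L-shaped region with outer corners at g₁ and g₂.

  shift : ∀ {t} k x y d → t + a * k ≡ b * x + c * y + a * d →
    (∀ k′ → k ≡ d + k′ → t + a * k′ ≡ b * x + c * y → Outcome t) → Outcome t
  shift {t} k x y d eq ih with ≤-total k d
  -- The move releases at least k copies of a, and the surplus d - k is the coefficient of a in t.
  ... | inj₁ k≤d with d′ , refl ← m≤n⇒∃[o]m+o≡n k≤d =
    inj₁ (d′ , x , y , +-cancelʳ-≡ (a * k) _ _ (trans eq (lemma a b c x y k d′)))
    where
    lemma : ∀ a b c x y k d →
      b * x + c * y + a * (k + d) ≡ a * d + b * x + c * y + a * k
    lemma = solve-∀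
  ... | inj₂ d≤k with k′ , refl ← m≤n⇒∃[o]m+o≡n d≤k =
    ih k′ refl (+-cancelʳ-≡ (a * d) _ _ (trans (lemma a t d k′) eq))
    where
    lemma : ∀ a t d k → t + a * k + a * d ≡ t + a * (d + k)
    lemma = solve-∀

  -- Since k ≥ 1, the left side already contains one a; the two strict inequalities supply b and c.
  corner : ∀ {t} k x y .{{_ : NonZero k}} → t + a * k ≡ b * x + c * y →
    ∀ {X Y} → x < X → y < Y → t + e₁ a b c ≤ b * X + c * Y
  corner {t} k@(suc _) x y eq {X} {Y} x<X y<Y = begin
    t + (a + b + c)          ≡⟨ l₁ t a b c ⟩
    t + a * 1 + (b + c)      ≤⟨ +-monoˡ-≤ (b + c) (+-monoʳ-≤ t (*-monoʳ-≤ a (s≤s z≤n))) ⟩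
    t + a * k + (b + c)      ≡⟨ cong (_+ (b + c)) eq ⟩
    b * x + c * y + (b + c)  ≡⟨ l₂ b c x y ⟩
    b * (1 + x) + c * (1 + y) ≤⟨ +-mono-≤ (*-monoʳ-≤ b x<X) (*-monoʳ-≤ c y<Y) ⟩
    b * X + c * Y            ∎
    where
    open ≤-Reasoning
    l₁ : ∀ t a b c → t + (a + b + c) ≡ t + a * 1 + (b + c)
    l₁ = solve-∀
    l₂ : ∀ b c x y → b * x + c * y + (b + c) ≡ b * (1 + x) + c * (1 + y)
    l₂ = solve-∀

  -- The lexicographic order is flattened to (p + 1) k + y. Subtracting (s + α , - p) raises y by p
  -- but lowers k by u ≥ 1; the other two moves never raise k and lower y by at least β ≥ 1.
  descend : ∀ t k x y → t + a * k ≡ b * x + c * y → Acc _<_ (suc p * k + y) → Outcome t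
  descend t zero x y eq _ = inj₁ (0 , x , y , (begin
    t                      ≡⟨ lemma a t ⟩
    t + a * 0              ≡⟨ eq ⟩
    b * x + c * y          ≡⟨ cong (_+ c * y) (cong (_+ b * x) (*-zeroʳ a)) ⟨
    a * 0 + b * x + c * y  ∎))
    where
    open ≡-Reasoning
    lemma : ∀ a t → t ≡ t + a * 0
    lemma = solve-∀
  descend t k@(suc _) x y eq (acc rec) with s + α ≤? x
  ... | yes T≤x with x′ , refl ← m≤n⇒∃[o]m+o≡n T≤x =
    shift k x′ (y + p) u (trans eq eq′) λ k′ k≡ eq″ →
      descend t k′ x′ (y + p) eq″ (rec (smaller k′ k≡))
    where
    lemma : ∀ b c T x y p q → b * T ≡ c * p + q →
            b * (T + x) + c * y ≡ b * x + c * (y + p) + q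
    lemma b c T x y p q h = begin
      b * (T + x) + c * y              ≡⟨ l₁ b c T x y ⟩
      b * T + (b * x + c * y)          ≡⟨ cong (_+ (b * x + c * y)) h ⟩
      c * p + q + (b * x + c * y)      ≡⟨ l₂ b c x y p q ⟩
      b * x + c * (y + p) + q          ∎
      where
      open ≡-Reasoning
      l₁ : ∀ b c T x y → b * (T + x) + c * y ≡ b * T + (b * x + c * y)
      l₁ = solve-∀
      l₂ : ∀ b c x y p q → c * p + q + (b * x + c * y) ≡ b * x + c * (y + p) + q
      l₂ = solve-∀
    eq′ = lemma b c (s + α) x′ y p (a * u) relation₁
    smaller : ∀ {k} k′ → k ≡ u + k′ → suc p * k′ + (y + p) < suc p * k + y
    smaller k′ refl = begin-strict
      suc p * k′ + (y + p)          <⟨ +-monoʳ-< (suc p * k′) (+-monoʳ-< y (n<1+n p)) ⟩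
      suc p * k′ + (y + suc p)      ≡⟨ l (suc p) k′ y ⟩
      suc p * (1 + k′) + y          ≤⟨ +-monoˡ-≤ y (*-monoʳ-≤ (suc p) (+-monoˡ-≤ k′ 0<u)) ⟩
      suc p * (u + k′) + y          ∎
      where
      open ≤-Reasoning
      l : ∀ p k y → p * k + (y + p) ≡ p * (1 + k) + y
      l = solve-∀
  ... | no T≰x with p + β ≤? y
  ...   | yes Q≤y with y′ , refl ← m≤n⇒∃[o]m+o≡n Q≤y =
    shift k (x + s) y′ w (trans eq eq′) λ k′ k≡ eq″ →
      descend t k′ (x + s) y′ eq″ (rec (smaller k′ k≡))
    where
    lemma : ∀ b c Q x y s q → c * Q ≡ b * s + q →
            b * x + c * (Q + y) ≡ b * (x + s) + c * y + q
    lemma b c Q x y s q h = begin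
      b * x + c * (Q + y)              ≡⟨ l₁ b c Q x y ⟩
      c * Q + (b * x + c * y)          ≡⟨ cong (_+ (b * x + c * y)) h ⟩
      b * s + q + (b * x + c * y)      ≡⟨ l₂ b c x y s q ⟩
      b * (x + s) + c * y + q          ∎
      where
      open ≡-Reasoning
      l₁ : ∀ b c Q x y → b * x + c * (Q + y) ≡ c * Q + (b * x + c * y)
      l₁ = solve-∀
      l₂ : ∀ b c x y s q → b * s + q + (b * x + c * y) ≡ b * (x + s) + c * y + q
      l₂ = solve-∀
    eq′ = lemma b c (p + β) x y′ s (a * w) relation₂
    smaller : ∀ {k} k′ → k ≡ w + k′ → suc p * k′ + y′ < suc p * k + (p + β + y′)
    smaller k′ refl = +-mono-≤-< (*-monoʳ-≤ (suc p) (m≤n+m k′ w))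
      (+-monoˡ-≤ y′ (≤-trans 0<β (m≤n+m β p)))
  ...   | no Q≰y with α ≤? x | β ≤? y
  ...     | yes α≤x | yes β≤y
          with x′ , refl ← m≤n⇒∃[o]m+o≡n α≤x | y′ , refl ← m≤n⇒∃[o]m+o≡n β≤y =
    shift k x′ y′ (u + w) (trans eq eq′) λ k′ k≡ eq″ →
      descend t k′ x′ y′ eq″ (rec (smaller k′ k≡))
    where
    lemma : ∀ b c α β x y q → b * α + c * β ≡ q →
            b * (α + x) + c * (β + y) ≡ b * x + c * y + q
    lemma b c α β x y q h =
      trans (l b c α β x y) (cong ((b * x + c * y) +_) h)
      where
      l : ∀ b c α β x y → b * (α + x) + c * (β + y) ≡ b * x + c * y + (b * α + c * β)
      l = solve-∀
    eq′ = lemma b c α β x′ y′ (a * (u + w)) relation₃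
    smaller : ∀ {k} k′ → k ≡ u + w + k′ → suc p * k′ + y′ < suc p * k + (β + y′)
    smaller k′ refl = +-mono-≤-< (*-monoʳ-≤ (suc p) (m≤n+m k′ (u + w)))
      (+-monoˡ-≤ y′ 0<β)
  ...     | no α≰x | _      = inj₂ (inj₁ (corner k x y eq (≰⇒> α≰x) (≰⇒> Q≰y)))
  ...     | _      | no β≰y = inj₂ (inj₂ (corner k x y eq (≰⇒> T≰x) (≰⇒> β≰y)))

-- Bounds at the two corners, degenerate bases included

bounds-swap′ : ∀ a b c {g} → Bounds a b c g → Bounds a c b g
bounds-swap′ a b c bd = bounds-rotate b a c (bounds-swap a b c bd)

bounds-generic : ∀ {a b c} s p α β u w →
  0 < s → 0 < p → 0 < α → 0 < β → 0 < u → 0 < w →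
  a ≡ s * β + α * p + α * β → b ≡ u * (p + β) + w * p → c ≡ u * s + w * (s + α) →
  Bounds a b c (b * α + c * (p + β))
bounds-generic (suc s) (suc p) (suc α) (suc β) (suc u) (suc w) _ _ _ _ _ _ refl refl refl =
  quadratic⇒bounds _ _ _ _ (quadratic-generic s p α β u w)

-- With s = 0, α divides a and c, so α = 1, a = p + β and c = w. Hence b = u a + p c, and the first
-- corner is exactly a c + b; the second is no larger.
bounds-s≡0 : ∀ {a b c} p α β u w → 0 < a → 0 < b → 0 < c →
  Coprime a b → Coprime a c → Coprime b c →
  a ≡ α * p + α * β → b ≡ u * (p + β) + w * p → c ≡ u * 0 + w * α →
  Bounds a b c (b * α + c * (p + β)) × Bounds a b c (b * α + c * β)
bounds-s≡0 {a} {b} {c} p α β u w 0<a 0<b 0<c a⊥b a⊥c b⊥c a≡ b≡ c≡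
  with refl ← a⊥c (subst (α ∣_) (sym a≡) (∣m∣n⇒∣m+n (m∣m*n p) (m∣m*n β)) ,
                   subst (α ∣_) (sym c≡) (subst (λ t → α ∣ t + w * α) (sym (*-zeroʳ u)) (n∣m*n w))) =
  bounds-antitone (≤-reflexive g₁≡) bd , bounds-antitone g₂≤ bd
  where
  lemma₁ : ∀ p β → 1 * p + 1 * β ≡ p + β
  lemma₁ = solve-∀
  lemma₂ : ∀ u w → u * 0 + w * 1 ≡ w
  lemma₂ = solve-∀
  lemma₃ : ∀ a b c → b * 1 + c * a ≡ a * c + b
  lemma₃ = solve-∀
  a≡p+β = trans a≡ (lemma₁ p β)
  c≡w   = trans c≡ (lemma₂ u w)
  bd : Bounds a b c (a * c + b)
  bd = bounds-swap′ a c b (bounds-combination 0<a 0<c 0<b (Coprimality.sym a⊥b) b⊥c u p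
    (trans b≡ (cong₂ (λ x y → u * x + y) (sym a≡p+β)
      (trans (*-comm w p) (cong (p *_) (sym c≡w))))))
  g₁≡ : b * 1 + c * (p + β) ≡ a * c + b
  g₁≡ = trans (cong (λ t → b * 1 + c * t) (sym a≡p+β)) (lemma₃ a b c)
  g₂≤ : b * 1 + c * β ≤ a * c + b
  g₂≤ = ≤-trans (+-monoʳ-≤ (b * 1) (*-monoʳ-≤ c (m≤n+m β p))) (≤-reflexive g₁≡)

-- With w = 0, u divides b and c, so u = 1, b = p + β and c = s. Hence a = α b + β c, and the second
-- corner is exactly b c + a; the first falls short of it by c β.
bounds-w≡0 : ∀ {a b c} s p α β u → 0 < a → 0 < b → 0 < c →
  Coprime a b → Coprime a c → Coprime b c →
  a ≡ s * β + α * p + α * β → b ≡ u * (p + β) + 0 → c ≡ u * s + 0 →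
  Bounds a b c (b * α + c * (p + β)) × Bounds a b c (b * (s + α) + c * β)
bounds-w≡0 {a} {b} {c} s p α β u 0<a 0<b 0<c a⊥b a⊥c b⊥c a≡ b≡ c≡
  with refl ← b⊥c (subst (u ∣_) (sym (trans b≡ (+-identityʳ _))) (m∣m*n (p + β)) ,
                   subst (u ∣_) (sym (trans c≡ (+-identityʳ _))) (m∣m*n s)) =
  bounds-antitone (≤-trans (m≤m+n _ (c * β)) (≤-reflexive g₁≡)) bd ,
  bounds-antitone (≤-reflexive g₂≡) bd
  where
  lemma₁ : ∀ n → 1 * n + 0 ≡ n
  lemma₁ = solve-∀
  lemma₂ : ∀ s p α β → s * β + α * p + α * β ≡ α * (p + β) + β * s
  lemma₂ = solve-∀
  lemma₃ : ∀ b c α β → b * α + c * b + c * β ≡ b * c + (α * b + β * c)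
  lemma₃ = solve-∀
  lemma₄ : ∀ b c α β → b * (c + α) + c * β ≡ b * c + (α * b + β * c)
  lemma₄ = solve-∀
  b≡p+β = trans b≡ (lemma₁ (p + β))
  c≡s   = trans c≡ (lemma₁ s)
  a≡αb+βc : a ≡ α * b + β * c
  a≡αb+βc = trans a≡ (trans (lemma₂ s p α β)
    (cong₂ (λ x y → α * x + β * y) (sym b≡p+β) (sym c≡s)))
  bd : Bounds a b c (b * c + a)
  bd = bounds-rotate c a b (bounds-rotate b c a
    (bounds-combination 0<b 0<c 0<a a⊥b a⊥c α β a≡αb+βc))
  g₁≡ : b * α + c * (p + β) + c * β ≡ b * c + a
  g₁≡ = trans (cong (λ t → b * α + c * t + c * β) (sym b≡p+β))
    (trans (lemma₃ b c α β) (cong (b * c +_) (sym a≡αb+βc)))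
  g₂≡ : b * (s + α) + c * β ≡ b * c + a
  g₂≡ = trans (cong (λ t → b * (t + α) + c * β) (sym c≡s))
    (trans (lemma₄ b c α β) (cong (b * c +_) (sym a≡αb+βc)))

-- The two corners of the L-shape are exchanged by the symmetry
-- b ↔ c, s ↔ p, α ↔ β, u ↔ w.

bounds-reduced : ∀ {a b c} → 0 < a → 0 < b → 0 < c →
  Coprime a b → Coprime a c → Coprime b c → (R : ReducedBasis a b c) →
  Bounds a b c (g₁ R) × Bounds a b c (g₂ R)
bounds-reduced {a} {b} {c} 0<a 0<b 0<c a⊥b a⊥c b⊥c
  record { s = s; p = p; u = u; α = α; β = β; w = w
         ; 0<u = 0<u; 0<α = 0<α; 0<β = 0<β; a≡ = a≡; b≡ = b≡; c≡ = c≡ } = cases s p w a≡ b≡ c≡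
  where
  lemma-a : ∀ s p α β → s * β + α * p + α * β ≡ p * α + β * s + β * α
  lemma-a = solve-∀
  cases : ∀ s p w → a ≡ s * β + α * p + α * β →
    b ≡ u * (p + β) + w * p → c ≡ u * s + w * (s + α) →
    Bounds a b c (b * α + c * (p + β)) × Bounds a b c (b * (s + α) + c * β)
  cases zero p w a≡ b≡ c≡ =
    bounds-s≡0 p α β u w 0<a 0<b 0<c a⊥b a⊥c b⊥c a≡ b≡ c≡
  cases s zero w a≡ b≡ c≡ =
    let bd₂ , bd₁ = bounds-s≡0 s β α w u 0<a 0<c 0<b a⊥c a⊥b (Coprimality.sym b⊥c)
          (trans a≡ (lemma-a s 0 α β))
          (trans c≡ (+-comm (u * s) _)) (trans b≡ (+-comm (u * β) _))
    in subst (Bounds a b c) (+-comm (c * β) _) (bounds-swap′ a c b bd₁) ,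
       subst (Bounds a b c) (+-comm (c * β) _) (bounds-swap′ a c b bd₂)
  cases s p zero a≡ b≡ c≡ =
    bounds-w≡0 s p α β u 0<a 0<b 0<c a⊥b a⊥c b⊥c a≡ b≡ c≡
  cases s@(suc _) p@(suc _) w@(suc _) a≡ b≡ c≡ =
    bounds-generic s p α β u w 0<1+n 0<1+n 0<α 0<β 0<u 0<1+n a≡ b≡ c≡ ,
    subst (Bounds a b c) (+-comm (c * β) _) (bounds-swap′ a c b
      (bounds-generic p s β α w u 0<1+n 0<1+n 0<β 0<α 0<1+n 0<u
        (trans a≡ (lemma-a s p α β))
        (trans c≡ (+-comm (u * s) _)) (trans b≡ (+-comm (u * (p + β)) _))))

-- The descent starts on the axis y = 0, where coprimality of a and b solves t + a k = b x.
combination-or-bounds : ∀ {a b c} → 0 < a → 0 < b → 0 < c →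
  Coprime a b → Coprime a c → Coprime b c → ∀ t →
  Combination a b c t ⊎ Bounds a b c (t + e₁ a b c)
combination-or-bounds {a} {b} {c} 0<a 0<b 0<c a⊥b a⊥c b⊥c t =
  [ inj₁
  , inj₂ ∘ [ (λ t≤g₁ → bounds-antitone t≤g₁ (proj₁ bds))
           , (λ t≤g₂ → bounds-antitone t≤g₂ (proj₂ bds)) ]′
  ]′ (descend R t k x 0 eq (<-wellFounded _))
  where
  R = reducedBasis 0<a 0<b 0<c a⊥b
  bds = bounds-reduced 0<a 0<b 0<c a⊥b a⊥c b⊥c R
  solution = coprime⇒solvable 0<a 0<b (Coprimality.sym a⊥b) t
  k = proj₁ solution
  x = proj₁ (proj₂ solution)
  eq : t + a * k ≡ b * x + c * 0
  eq = trans (proj₂ (proj₂ solution))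
    (sym (trans (cong (b * x +_) (*-zeroʳ c)) (+-identityʳ _)))

-- From three generators to the Frobenius number of the whole vector

module _ {m} {a b c : ℕ} {as : Vec ℕ m} where

  combination⇒representable : ∀ {t} → Combination a b c t →
                              Representable (a ∷ b ∷ c ∷ as) (ℤ.+ t)
  combination⇒representable {t} (x , y , z , t≡) =
    x ∷ y ∷ z ∷ Vec.replicate m 0 , cong ℤ.+_ (begin
      t                                            ≡⟨ t≡ ⟩
      a * x + b * y + c * z                        ≡⟨ lemma (a * x) (b * y) (c * z) ⟩
      a * x + (b * y + (c * z + 0))                ≡⟨ cong (λ r → a * x + (b * y + (c * z + r))) (rest as) ⟨
      a * x + (b * y + (c * z + Vec.sum (Vec.zipWith _*_ as (Vec.replicate m 0)))) ∎)
    where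
    open ≡-Reasoning
    lemma : ∀ x y z → x + y + z ≡ x + (y + (z + 0))
    lemma = solve-∀
    rest : ∀ {n} (ds : Vec ℕ n) → Vec.sum (Vec.zipWith _*_ ds (Vec.replicate n 0)) ≡ 0
    rest []       = refl
    rest (d ∷ ds) = cong₂ _+_ (*-zeroʳ d) (rest ds)

  -- A nonrepresentable t ≥ 0 is no combination of the first three entries, so `Bounds` holds at g =
  -- t + `e₁`, and n = 2 t + `e₁` satisfies n + `e₁` = 2 g.
  frobenius-bound : 0 < a → 0 < b → 0 < c → Coprime a b → Coprime a c → Coprime b c →
    ∀ F → IsFrobeniusNumber (a ∷ b ∷ c ∷ as) F →
    ∃[ n ] F ℤ.+ F ℤ.+ ℤ.+ e₁ a b c ≡ ℤ.+ n ×
      3 * (n * n) + 4 * e₂ a b c ≤ e₁ a b c * e₁ a b c + 2 * (e₁ a b c * e₃ a b c)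
  frobenius-bound 0<a 0<b 0<c a⊥b a⊥c b⊥c (ℤ.+ t) (¬rep , _)
    with combination-or-bounds 0<a 0<b 0<c a⊥b a⊥c b⊥c t
  ... | inj₁ comb        = contradiction (combination⇒representable comb) ¬rep
  ... | inj₂ (bounds bd) =
    t + t + e₁ a b c , refl , bd (t + t + e₁ a b c) (≤-reflexive (lemma t (e₁ a b c)))
    where
    lemma : ∀ t s → t + t + s + s ≡ 2 * (t + s)
    lemma = solve-∀
  -- -1 is never representable, so F cannot lie below it.
  frobenius-bound 0<a 0<b 0<c _ _ _ -[1+ suc k ] (_ , greatest)
    with ℤ.-≤- () ← greatest -[1+ 0 ] (λ { (_ , ()) })
  -- For F = -1, n is `e₁` - 2, and g = n + 1 = `e₁` - 1 falls under `bounds-trivial`.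
  frobenius-bound 0<a 0<b 0<c _ _ _ -[1+ 0 ] _
    with n , 2+n≡s ← m≤n⇒∃[o]m+o≡n (+-mono-≤ (+-mono-≤ 0<a 0<b) (z≤n {c})) =
    n , cong (λ s → -[1+ 1 ] ℤ.+ ℤ.+ s) (sym 2+n≡s) ,
    bd n (≤-reflexive (trans (cong (n +_) (sym 2+n≡s)) (lemma n)))
    where
    open Bounds (bounds-trivial {g = 1 + n} 0<a 0<b 0<c (≤-reflexive 2+n≡s)) renaming (bound to bd)
    lemma : ∀ n → n + (2 + n) ≡ 2 * (1 + n)
    lemma = solve-∀

-- Rational and real arithmetic

-- Normalisation by a gcd blocks evaluation in ℚ, so the identity is checked on unnormalised
-- fractions with denominator 1.
/1-homo-+ : ∀ i j → (i ℤ.+ j) ℚ./ 1 ≡ i ℚ./ 1 ℚ.+ j ℚ./ 1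
/1-homo-+ i j = ℚ.toℚᵘ-injective (begin
  ℚ.toℚᵘ ((i ℤ.+ j) ℚ./ 1)                       ≈⟨ ℚ.toℚᵘ-fromℚᵘ (ℚᵘ.mkℚᵘ (i ℤ.+ j) 0) ⟩
  ℚᵘ.mkℚᵘ (i ℤ.+ j) 0                           ≈⟨ ℚᵘ.*≡* (cong (ℤ._* ℤ.+ 1)
    (sym (cong₂ ℤ._+_ (ℤ.*-identityʳ i) (ℤ.*-identityʳ j)))) ⟩
  ℚᵘ.mkℚᵘ i 0 ℚᵘ.+ ℚᵘ.mkℚᵘ j 0                  ≈⟨ ℚᵘ.+-cong (ℚ.toℚᵘ-fromℚᵘ (ℚᵘ.mkℚᵘ i 0))
    (ℚ.toℚᵘ-fromℚᵘ (ℚᵘ.mkℚᵘ j 0)) ⟨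
  ℚ.toℚᵘ (i ℚ./ 1) ℚᵘ.+ ℚ.toℚᵘ (j ℚ./ 1)         ≈⟨ ℚ.toℚᵘ-homo-+ (i ℚ./ 1) (j ℚ./ 1) ⟨
  ℚ.toℚᵘ (i ℚ./ 1 ℚ.+ j ℚ./ 1)                   ∎)
  where open ℚᵘ.≃-Reasoning

/1-homo-* : ∀ i j → (i ℤ.* j) ℚ./ 1 ≡ (i ℚ./ 1) ℚ.* (j ℚ./ 1)
/1-homo-* i j = ℚ.toℚᵘ-injective (begin
  ℚ.toℚᵘ ((i ℤ.* j) ℚ./ 1)                       ≈⟨ ℚ.toℚᵘ-fromℚᵘ (ℚᵘ.mkℚᵘ (i ℤ.* j) 0) ⟩
  ℚᵘ.mkℚᵘ i 0 ℚᵘ.* ℚᵘ.mkℚᵘ j 0                  ≈⟨ ℚᵘ.*-cong (ℚ.toℚᵘ-fromℚᵘ (ℚᵘ.mkℚᵘ i 0))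
    (ℚ.toℚᵘ-fromℚᵘ (ℚᵘ.mkℚᵘ j 0)) ⟨
  ℚ.toℚᵘ (i ℚ./ 1) ℚᵘ.* ℚ.toℚᵘ (j ℚ./ 1)         ≈⟨ ℚ.toℚᵘ-homo-* (i ℚ./ 1) (j ℚ./ 1) ⟨
  ℚ.toℚᵘ ((i ℚ./ 1) ℚ.* (j ℚ./ 1))               ∎)
  where open ℚᵘ.≃-Reasoning

fromℕ-homo-+ : ∀ m n → fromℕ (m + n) ≡ fromℕ m ℚ.+ fromℕ n
fromℕ-homo-+ m n = /1-homo-+ (ℤ.+ m) (ℤ.+ n)

fromℕ-homo-* : ∀ m n → fromℕ (m * n) ≡ fromℕ m ℚ.* fromℕ n
fromℕ-homo-* m n = trans (cong (ℚ._/ 1) (ℤ.pos-* m n)) (/1-homo-* (ℤ.+ m) (ℤ.+ n))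

fromℕ-mono-≤ : ∀ {m n} → m ≤ n → fromℕ m ℚ.≤ fromℕ n
fromℕ-mono-≤ {m} m≤n with o , refl ← m≤n⇒∃[o]m+o≡n m≤n =
  subst₂ ℚ._≤_ (ℚ.+-identityʳ (fromℕ m)) (sym (fromℕ-homo-+ m o))
    (ℚ.+-monoʳ-≤ (fromℕ m) (ℚ.nonNegative⁻¹ (fromℕ o) {{ℚ.normalize-nonNeg o 1}}))

<⇒∈√ : ∀ {p x n} .{{_ : ℚ.NonNegative p}} → x ℚ.< fromℕ n → fromℕ (n * n) ℚ.≤ p → ℝ.L (√ p) x
<⇒∈√ {p} {x} {n} x<n n²≤p with x ℚ.<? 0ℚ
... | yes x<0 = inj₁ x<0
... | no  x≮0 = inj₂ (begin-strict
  x ℚ.* x                 ≤⟨ ℚ.*-monoˡ-≤-nonNeg x {{ℚ.nonNegative 0≤x}} (ℚ.<⇒≤ x<n) ⟩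
  x ℚ.* fromℕ n           <⟨ ℚ.*-monoˡ-<-pos (fromℕ n) {{ℚ.positive (ℚ.≤-<-trans 0≤x x<n)}} x<n ⟩
  fromℕ n ℚ.* fromℕ n     ≡⟨ fromℕ-homo-* n n ⟨
  fromℕ (n * n)           ≤⟨ n²≤p ⟩
  p                       ∎)
  where
  open ℚ.≤-Reasoning
  0≤x = ℚ.≮⇒≥ x≮0

module _ (a b c : ℕ) where

  private
    s = e₁ a b c
    t = e₂ a b c
    r = e₃ a b c

  fromℕ-e₁ : fromℕ s ≡ fromℕ a ℚ.+ fromℕ b ℚ.+ fromℕ c
  fromℕ-e₁ = trans (fromℕ-homo-+ (a + b) c) (cong (ℚ._+ fromℕ c) (fromℕ-homo-+ a b))

  fromℕ-e₂ : fromℕ t ≡ fromℕ a ℚ.* fromℕ b ℚ.+ fromℕ b ℚ.* fromℕ c ℚ.+ fromℕ c ℚ.* fromℕ a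
  fromℕ-e₂ = trans (fromℕ-homo-+ (a * b + b * c) (c * a)) (cong₂ ℚ._+_
    (trans (fromℕ-homo-+ (a * b) (b * c)) (cong₂ ℚ._+_ (fromℕ-homo-* a b) (fromℕ-homo-* b c)))
    (fromℕ-homo-* c a))

  fromℕ-e₃ : fromℕ r ≡ fromℕ a ℚ.* fromℕ b ℚ.* fromℕ c
  fromℕ-e₃ = trans (fromℕ-homo-* (a * b) c) (cong (ℚ._* fromℕ c) (fromℕ-homo-* a b))

  radicand₂≡ : radicand₂ a b c ≡ fromℕ (s * r)
  radicand₂≡ = begin
    radicand₂ a b c          ≡⟨ ℚ.*-comm (fromℕ a ℚ.* fromℕ b ℚ.* fromℕ c) _ ⟩
    (fromℕ a ℚ.+ fromℕ b ℚ.+ fromℕ c) ℚ.* (fromℕ a ℚ.* fromℕ b ℚ.* fromℕ c)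
                             ≡⟨ cong₂ ℚ._*_ fromℕ-e₁ fromℕ-e₃ ⟨
    fromℕ s ℚ.* fromℕ r      ≡⟨ fromℕ-homo-* s r ⟨
    fromℕ (s * r)            ∎
    where open ≡-Reasoning

  -- Clearing the denominator 3 reduces comparisons with this radicand to inequalities in ℕ.
  3*radicand₁≡ : fromℕ 3 ℚ.* radicand₁ a b c ≡ fromℕ (s * s + 2 * (s * r) + 8 * t)
  3*radicand₁≡ = begin
    fromℕ 3 ℚ.* radicand₁ a b c
      ≡⟨ solve 3 (λ a b c →
           let s = a :+ b :+ c; t = a :* b :+ b :* c :+ c :* a; r = a :* b :* c in
           con (fromℕ 3) :*
             (con (ℤ.+ 1 ℚ./ 3) :* s :* (s :+ con (ℤ.+ 2 ℚ./ 1) :* a :* b :* c) :+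
              con (ℤ.+ 8 ℚ./ 3) :* t) :=
           s :* s :+ con (fromℕ 2) :* (s :* r) :+ con (fromℕ 8) :* t)
           refl (fromℕ a) (fromℕ b) (fromℕ c) ⟩
    S ℚ.* S ℚ.+ fromℕ 2 ℚ.* (S ℚ.* (A ℚ.* B ℚ.* C)) ℚ.+
      fromℕ 8 ℚ.* (A ℚ.* B ℚ.+ B ℚ.* C ℚ.+ C ℚ.* A)
      ≡⟨ cong₂ (λ x (y , z) → x ℚ.* x ℚ.+ fromℕ 2 ℚ.* (x ℚ.* z) ℚ.+ fromℕ 8 ℚ.* y)
           fromℕ-e₁ (cong₂ _,_ fromℕ-e₂ fromℕ-e₃) ⟨
    fromℕ s ℚ.* fromℕ s ℚ.+ fromℕ 2 ℚ.* (fromℕ s ℚ.* fromℕ r) ℚ.+ fromℕ 8 ℚ.* fromℕ t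
      ≡⟨ cong₂ ℚ._+_ (cong₂ ℚ._+_ (fromℕ-homo-* s s)
           (trans (fromℕ-homo-* 2 (s * r)) (cong (fromℕ 2 ℚ.*_) (fromℕ-homo-* s r))))
           (fromℕ-homo-* 8 t) ⟨
    fromℕ (s * s) ℚ.+ fromℕ (2 * (s * r)) ℚ.+ fromℕ (8 * t)
      ≡⟨ trans (fromℕ-homo-+ (s * s + 2 * (s * r)) (8 * t))
           (cong (ℚ._+ fromℕ (8 * t)) (fromℕ-homo-+ (s * s) (2 * (s * r)))) ⟨
    fromℕ (s * s + 2 * (s * r) + 8 * t) ∎
    where
    open ≡-Reasoning
    open +-*-Solver
    A = fromℕ a
    B = fromℕ b
    C = fromℕ c
    S = A ℚ.+ B ℚ.+ C

  square≤radicand₁ : ∀ {n} → 3 * (n * n) + 4 * t ≤ s * s + 2 * (s * r) →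
                     fromℕ (n * n) ℚ.≤ radicand₁ a b c
  square≤radicand₁ {n} h = ℚ.*-cancelˡ-≤-pos (fromℕ 3) (begin
    fromℕ 3 ℚ.* fromℕ (n * n)                ≡⟨ fromℕ-homo-* 3 (n * n) ⟨
    fromℕ (3 * (n * n))                      ≤⟨ fromℕ-mono-≤ {3 * (n * n)}
      (≤-trans (m≤m+n _ (4 * t)) (≤-trans h (m≤m+n _ (8 * t)))) ⟩
    fromℕ (s * s + 2 * (s * r) + 8 * t)      ≡⟨ 3*radicand₁≡ ⟨
    fromℕ 3 ℚ.* radicand₁ a b c              ∎)
    where open ℚ.≤-Reasoning

  -- This is where the term 4 `e₂` kept in `Bounds` is spent: it turns s² + 2 s r - 4 t into at most
  -- 3 s r, three times the second radicand.
  e₁²≤ : 0 < a → 0 < b → 0 < c → s * s ≤ s * r + 4 * t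
  e₁²≤ (s≤s {n = i} _) (s≤s {n = j} _) (s≤s {n = k} _) = coefficientwise-≤
    (e₁ᵉ x y z ⊗ e₁ᵉ x y z) (e₁ᵉ x y z ⊗ e₃ᵉ x y z ⊕ con 4 ⊗ e₂ᵉ x y z)
    _ (i ∷ j ∷ k ∷ [])
    where
    x y z : Expr 3
    x = sucᵉ 0F
    y = sucᵉ 1F
    z = sucᵉ 2F

  square≤radicand₂ : ∀ {n} → 0 < a → 0 < b → 0 < c →
                     3 * (n * n) + 4 * t ≤ s * s + 2 * (s * r) →
                     fromℕ (n * n) ℚ.≤ radicand₂ a b c
  square≤radicand₂ {n} 0<a 0<b 0<c h = subst (fromℕ (n * n) ℚ.≤_) (sym radicand₂≡)
    (fromℕ-mono-≤ {n * n} {s * r} (*-cancelˡ-≤ 3 (+-cancelʳ-≤ (4 * t) _ _ (begin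
      3 * (n * n) + 4 * t              ≤⟨ h ⟩
      s * s + 2 * (s * r)              ≤⟨ +-monoˡ-≤ _ (e₁²≤ 0<a 0<b 0<c) ⟩
      s * r + 4 * t + 2 * (s * r)      ≡⟨ lemma (s * r) t ⟩
      3 * (s * r) + 4 * t              ∎))))
    where
    open ≤-Reasoning
    lemma : ∀ x t → x + 4 * t + 2 * x ≡ 3 * x + 4 * t
    lemma = solve-∀

  -- Membership of q in the lower cut of `ub₁` or `ub₂` unfolds, through the inverse maps of `½·_`
  -- and `_⊖_`, to membership of q + q + c + b + a in the lower cut of the root.
  doubled<⇒ : ∀ F n → F ℤ.+ F ℤ.+ ℤ.+ s ≡ ℤ.+ n → ∀ {q} → q ℚ.< F ℚ./ 1 →
    q ℚ.+ q ℚ.+ fromℕ c ℚ.+ fromℕ b ℚ.+ fromℕ a ℚ.< fromℕ n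
  doubled<⇒ F n eq {q} q<F = begin-strict
    q ℚ.+ q ℚ.+ C ℚ.+ B ℚ.+ A
      ≡⟨ lemma q A B C ⟩
    q ℚ.+ q ℚ.+ (A ℚ.+ B ℚ.+ C)
      <⟨ ℚ.+-monoˡ-< (A ℚ.+ B ℚ.+ C) (ℚ.+-mono-< q<F q<F) ⟩
    F ℚ./ 1 ℚ.+ F ℚ./ 1 ℚ.+ (A ℚ.+ B ℚ.+ C)
      ≡⟨ cong₂ ℚ._+_ (/1-homo-+ F F) fromℕ-e₁ ⟨
    (F ℤ.+ F) ℚ./ 1 ℚ.+ fromℕ s
      ≡⟨ /1-homo-+ (F ℤ.+ F) (ℤ.+ s) ⟨
    (F ℤ.+ F ℤ.+ ℤ.+ s) ℚ./ 1
      ≡⟨ cong (ℚ._/ 1) eq ⟩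
    fromℕ n ∎
    where
    open ℚ.≤-Reasoning
    A = fromℕ a
    B = fromℕ b
    C = fromℕ c
    lemma : ∀ q a b c → q ℚ.+ q ℚ.+ c ℚ.+ b ℚ.+ a ≡ q ℚ.+ q ℚ.+ (a ℚ.+ b ℚ.+ c)
    lemma = solve 4 (λ q a b c → q :+ q :+ c :+ b :+ a := q :+ q :+ (a :+ b :+ c)) refl
      where open +-*-Solver

  -- Three times the difference of the radicands is s r - s² - 8 t.
  radicand₁≤radicand₂ : s * s + 8 * t ≤ s * r → radicand₁ a b c ℚ.≤ radicand₂ a b c
  radicand₁≤radicand₂ h = ℚ.*-cancelˡ-≤-pos (fromℕ 3) (begin
    fromℕ 3 ℚ.* radicand₁ a b c              ≡⟨ 3*radicand₁≡ ⟩
    fromℕ (s * s + 2 * (s * r) + 8 * t)      ≤⟨ fromℕ-mono-≤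
      {s * s + 2 * (s * r) + 8 * t} {3 * (s * r)} h′ ⟩
    fromℕ (3 * (s * r))                      ≡⟨ fromℕ-homo-* 3 (s * r) ⟩
    fromℕ 3 ℚ.* fromℕ (s * r)                ≡⟨ cong (fromℕ 3 ℚ.*_) radicand₂≡ ⟨
    fromℕ 3 ℚ.* radicand₂ a b c              ∎)
    where
    open ℚ.≤-Reasoning
    lemma : ∀ x y z → x + 2 * y + z ≡ x + z + 2 * y
    lemma = solve-∀
    h′ : s * s + 2 * (s * r) + 8 * t ≤ 3 * (s * r)
    h′ = subst (_≤ 3 * (s * r)) (sym (lemma (s * s) (s * r) (8 * t))) (+-monoˡ-≤ (2 * (s * r)) h)

  -- The rational separating the bounds, carried back through the common affine map, separates the
  -- two roots, and its square separates the radicands.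
  ub₂<ub₁⇒radicand₂<radicand₁ : ub₂ a b c <ℝ ub₁ a b c → radicand₂ a b c ℚ.< radicand₁ a b c
  ub₂<ub₁⇒radicand₂<radicand₁ (_ , (0<x , _)     , inj₁ x<0)   = contradiction x<0 (ℚ.<-asym 0<x)
  ub₂<ub₁⇒radicand₂<radicand₁ (_ , (_   , r₂<x²) , inj₂ x²<r₁) = ℚ.<-trans r₂<x² x²<r₁

  ub₂<ub₁⇒ : ub₂ a b c <ℝ ub₁ a b c → s * r < s * s + 8 * t
  ub₂<ub₁⇒ ub₂<ub₁ = ≰⇒> λ h → ℚ.<-irrefl refl
    (ℚ.<-≤-trans (ub₂<ub₁⇒radicand₂<radicand₁ ub₂<ub₁) (radicand₁≤radicand₂ h))

-- Finite search for the exceptional triples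

Exceptional : ℕ → ℕ → ℕ → Set
Exceptional a b c =
  e₁ a b c * e₃ a b c < e₁ a b c * e₁ a b c + 8 * e₂ a b c → 0 < a →
  gcd a b ≡ 1 → gcd a c ≡ 1 → gcd b c ≡ 1 → (a , b , c) ∈ exceptions

exceptional? : ∀ a b c → Dec (Exceptional a b c)
exceptional? a b c =
  (e₁ a b c * e₃ a b c <? e₁ a b c * e₁ a b c + 8 * e₂ a b c) →-dec (0 <? a) →-dec
  (gcd a b ≟ 1) →-dec (gcd a c ≟ 1) →-dec (gcd b c ≟ 1) →-dec
  (a , b , c) ∈? exceptions
  where open import Data.List.Membership.DecPropositional (≡-dec _≟_ (≡-dec _≟_ _≟_))

allBelow : ℕ → (ℕ → Bool) → Bool
allBelow zero    f = true
allBelow (suc n) f = f n ∧ allBelow n f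

allBelow-sound : ∀ n f → T (allBelow n f) → ∀ {m} → m < n → T (f m)
allBelow-sound (suc n) f h {m} (s≤s m≤n) with m ≟ n
... | yes refl = proj₁ (Equivalence.to T-∧ h)
... | no  m≢n  = allBelow-sound n f (proj₂ (Equivalence.to T-∧ h)) (≤∧≢⇒< m≤n m≢n)

-- The whole search is one closed Boolean that evaluates to `true`, so its proof is `_`;
-- `allBelow-sound` then extracts the individual triple.
exceptional-below-25 : ∀ {a b c} → a < b → b ≤ c → c < 25 → Exceptional a b c
exceptional-below-25 {a} {b} {c} a<b b≤c c<25 = toWitness
  (allBelow-sound b _ (allBelow-sound (suc c) _ (allBelow-sound 25 test _ c<25) (s≤s b≤c)) a<b)
  where
  test : ℕ → Bool
  test c = allBelow (suc c) λ b → allBelow b λ a → isYes (exceptional? a b c)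

-- The evaluations stay neutral here: against 25 + k in place of z, the type
-- checker would compare the two sides by unfolding them into unary numerals.

e₁²+8e₂≤e₁e₃ : ∀ {n} (a b c : Expr n) →
  T (normalise (e₁ᵉ a b c ⊗ e₁ᵉ a b c ⊕ con 8 ⊗ e₂ᵉ a b c) ≤ᵖ
     normalise (e₁ᵉ a b c ⊗ e₃ᵉ a b c)) →
  ∀ ρ {x y z} → ⟦ a ⟧ ρ ≡ x → ⟦ b ⟧ ρ ≡ y → ⟦ c ⟧ ρ ≡ z →
  e₁ x y z * e₁ x y z + 8 * e₂ x y z ≤ e₁ x y z * e₃ x y z
e₁²+8e₂≤e₁e₃ a b c h ρ refl refl refl = coefficientwise-≤
  (e₁ᵉ a b c ⊗ e₁ᵉ a b c ⊕ con 8 ⊗ e₂ᵉ a b c) (e₁ᵉ a b c ⊗ e₃ᵉ a b c) h ρ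

-- The cutoff 25 comes from the triples (1 , 2 , c), where `e₁` `e₃` - `e₁`² - 8 `e₂` equals (c -
-- 25) (c + 1). From c = 25 on, with a ≥ 1 and b ≥ a + 1, the opposite inequality holds
-- coefficientwise.
exceptional : ∀ {a b c} → a < b → b ≤ c → Exceptional a b c
exceptional {a} {b} {c} a<b b≤c with c <? 25
... | yes c<25 = exceptional-below-25 a<b b≤c c<25
... | no c≮25  = λ h 0<a → contradiction h (≤⇒≯ (large 0<a))
  where
  large : 0 < a → e₁ a b c * e₁ a b c + 8 * e₂ a b c ≤ e₁ a b c * e₃ a b c
  large 0<a =
    let i , 1+i≡a = m≤n⇒∃[o]m+o≡n 0<a
        j , a+j≡b = m≤n⇒∃[o]m+o≡n a<b
        k , 25+k≡c = m≤n⇒∃[o]m+o≡n (≮⇒≥ c≮25)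
    in e₁²+8e₂≤e₁e₃ (sucᵉ 0F) (con 1 ⊕ sucᵉ 0F ⊕ var 1F) (con 25 ⊕ var 2F) _
         (i ∷ j ∷ k ∷ []) 1+i≡a (trans (cong (λ t → suc t + j) 1+i≡a) a+j≡b) 25+k≡c

theorem3 : ∀ {m : ℕ} (a : Vec ℕ (3 + m)) →
    (∀ i → 0 < lookup a i) →
    (∀ i j → i Fin.≤ j → lookup a i ≤ lookup a j) →
    (∀ i j → i ≢ j → gcd (lookup a i) (lookup a j) ≡ 1) →
    (∀ (F : ℤ) → IsFrobeniusNumber a F → fromℤ F ≤ℝ UB₁ a × fromℤ F ≤ℝ UB₂ a) ×
    (lookup a 0F < lookup a 1F → UB₂ a <ℝ UB₁ a →
    (lookup a 0F , lookup a 1F , lookup a 2F) ∈ exceptions)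
theorem3 (a ∷ b ∷ c ∷ as) positive sorted coprime =
  (λ F isFrobenius →
    let n , eq , h = frobenius-bound 0<a 0<b 0<c
          (gcd≡1⇒coprime a⊥b) (gcd≡1⇒coprime a⊥c) (gcd≡1⇒coprime b⊥c) F isFrobenius
    in (λ q q<F → <⇒∈√ {n = n} {{radicand₁-nonNeg a b c}}
         (doubled<⇒ a b c F n eq q<F) (square≤radicand₁ a b c {n} h)) ,
       (λ q q<F → <⇒∈√ {n = n} {{radicand₂-nonNeg a b c}}
         (doubled<⇒ a b c F n eq q<F) (square≤radicand₂ a b c {n} 0<a 0<b 0<c h))) ,
  (λ a<b ub₂<ub₁ → exceptional a<b (sorted 1F 2F (s≤s z≤n))
    (ub₂<ub₁⇒ a b c ub₂<ub₁) 0<a a⊥b a⊥c b⊥c)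
  where
  0<a = positive 0F
  0<b = positive 1F
  0<c = positive 2F
  a⊥b = coprime 0F 1F λ ()
  a⊥c = coprime 0F 2F λ ()
  b⊥c = coprime 1F 2F λ ()
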